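{- Let $s\in\mathbb{N}$, $m_1,m_2\in\mathbb{Z}$ and $t_1,t_2\in\mathbb{N}'$. The sequence $n\mapsto F_{t_1sn+m_1}F_{t_2sn+m_2}$ has $Z$ transform $$\mathcal{Z}\left(F_{t_1sn+m_1}F_{t_2sn+m_2}\right)=z\,\frac{\displaystyle\sum_{i=0}^{t_1+t_2}\sum_{j=0}^{i}(-1)^{\frac{(sj+2(s+1))(j+1)}{2}}\binom{t_1+t_2+1}{j}_{F_s}F_{m_1+t_1s(i-j)}F_{m_2+t_2s(i-j)}\,y^{\frac{sj(j-1)}{2}}z^{t_1+t_2-i}}{\displaystyle\sum_{i=0}^{t_1+t_2+1}(-1)^{\frac{(si+2(s+1))(i+1)}{2}}\binom{t_1+t_2+1}{i}_{F_s}y^{\frac{si(i-1)}{2}}z^{t_1+t_2+1-i}}.$$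
   Context: $\mathbb{N}=\{1,2,\dots\}$, $\mathbb{N}'=\mathbb{N}\cup\{0\}$. $x,y$ are indeterminates and we abbreviate $F_n=F_n(x,y)$. The bivariate Fibonacci polynomials are $F_0=0$, $F_1=1$, $F_{n+2}=xF_{n+1}+yF_n$, extended to negative indices by $F_{ -n}=-(-y)^{ -n}F_n$ ($n\in\mathbb{N}$). For $n,k\in\mathbb{N}'$ the bivariate $s$-Fibopolynomial is $\binom{n}{k}_{F_s}=\frac{F_{sn}F_{s(n-1)}\cdots F_{s(n-k+1)}}{F_sF_{2s}\cdots F_{ks}}$ (equal to $1$ for $k=0$ and $k=n$, and to $0$ if $k>n$). The $Z$ transform of a sequence $(a_n)_{n\ge0}$ is $\mathcal{Z}(a_n)=\sum_{n\ge0}a_nz^{ -n}$, regarded as a formal power series in $z^{ -1}$ with coefficients in $\mathbb{C}(x,y)$ (equivalently, for fixed complex $x,y$ with $y\neq0$, as a function of $z$ for $|z|$ large). -}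

module Defs where

open import Algebra.Apartness.Bundles using (HeytingField; HeytingCommutativeRing)
open import Algebra.Bundles using (CommutativeRing)
open import Algebra.Bundles.Raw using (RawRing; RawSemiring)
open import Algebra.Morphism.Structures using (IsRingHomomorphism)
open import Data.Empty.Irrelevant using (⊥-elim)
open import Data.Fin.Base as Fin using (Fin; toℕ)
open import Data.Integer.Base using (ℤ; +_; -[1+_])
open import Data.List.Base using (List; []; _∷_; foldr; map)
open import Data.List.Relation.Unary.All using (All; []; _∷_)
open import Data.List.Relation.Unary.Any as Any using (Any; here; there)
open import Data.Nat.Base as ℕ using (ℕ; zero; suc; _∸_; NonZero)
import Data.Nat.Properties as ℕ
open import Data.Product.Base using (Σ; ∃₂; _×_; _,_; proj₁; proj₂)
open import Function.Base using (_∘_)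
open import Level using (Level; _⊔_)
import Algebra.Apartness.Properties.HeytingCommutativeRing
import Algebra.Definitions
import Algebra.Definitions.RawSemiring
import Algebra.Properties.CommutativeSemigroup
import Relation.Binary.Reasoning.Setoid

private
  variable
    c ℓ₁ ℓ₂ c′ ℓ₁′ ℓ₂′ : Level

module RangeSum {c ℓ} (R : RawSemiring c ℓ) where
  open RawSemiring R
  open Algebra.Definitions.RawSemiring R using (sum)

  ∑≤ : ℕ → (ℕ → Carrier) → Carrier
  ∑≤ n f = sum {suc n} (f ∘ toℕ)

  infixl 5 ∑≤
  syntax ∑≤ n (λ i → e) = ∑[ i ≤ n ] e

------------------------------------------------------------------------
-- Formal Laurent series in z⁻¹, i.e. R((z⁻¹)): the ring which contains
-- both the power series in z⁻¹ and the polynomials in z.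

module LaurentSeries {c ℓ} (R : RawSemiring c ℓ) where
  open RawSemiring R
  open RangeSum R

  -- ⟨ d , a ⟩ is  z^d · Σ_{n ≥ 0} a(n) z⁻ⁿ.  Representations are not
  -- unique, since a(0) may vanish; hence the equality below.
  record Laurent : Set c where
    constructor ⟨_,_⟩
    field
      order : ℕ
      coeff : ℕ → Carrier

  -- ⟨ d , a ⟩ and ⟨ e + d , shift e a ⟩ are the same series.
  shift : ℕ → (ℕ → Carrier) → (ℕ → Carrier)
  shift zero    a n       = a n
  shift (suc e) a zero    = 0#
  shift (suc e) a (suc n) = shift e a n

  infix  4 _≈ᴸ_
  infixl 6 _+ᴸ_
  infixl 7 _*ᴸ_

  _≈ᴸ_ : Laurent → Laurent → Set ℓ
  ⟨ d , a ⟩ ≈ᴸ ⟨ e , b ⟩ = ∀ n → shift e a n ≈ shift d b n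

  _+ᴸ_ : Laurent → Laurent → Laurent
  ⟨ d , a ⟩ +ᴸ ⟨ e , b ⟩ = ⟨ d ℕ.+ e , (λ n → shift e a n + shift d b n) ⟩

  _*ᴸ_ : Laurent → Laurent → Laurent
  ⟨ d , a ⟩ *ᴸ ⟨ e , b ⟩ = ⟨ d ℕ.+ e , (λ n → ∑[ i ≤ n ] (a i * b (n ∸ i))) ⟩

  infix 8 _z^_
  _z^_ : Carrier → ℕ → Laurent
  r z^ d = ⟨ d , (λ { zero → r ; (suc _) → 0# }) ⟩

  0ᴸ 1ᴸ z : Laurent
  0ᴸ = 0# z^ 0
  1ᴸ = 1# z^ 0
  z  = 1# z^ 1

  laurentRawSemiring : RawSemiring c ℓ
  laurentRawSemiring = record
    { Carrier = Laurent ; _≈_ = _≈ᴸ_ ; _+_ = _+ᴸ_ ; _*_ = _*ᴸ_ ; 0# = 0ᴸ ; 1# = 1ᴸ }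

  open Algebra.Definitions _≈ᴸ_ using (Invertible)

  infix 4 _≐_÷_
  _≐_÷_ : Laurent → Laurent → Laurent → Set (c ⊔ ℓ)
  f ≐ g ÷ h = Σ (Invertible 1ᴸ _*ᴸ_ h) λ h⁻¹ → f ≈ᴸ g *ᴸ proj₁ h⁻¹

  𝒵 : (ℕ → Carrier) → Laurent
  𝒵 a = ⟨ 0 , a ⟩

------------------------------------------------------------------------
-- K = k(x,y): the field K is generated over k by the algebraically
-- independent elements x and y.

record RationalFunctionField (k : HeytingField c ℓ₁ ℓ₂) (K : HeytingField c′ ℓ₁′ ℓ₂′)
       : Set (c ⊔ ℓ₁ ⊔ ℓ₂ ⊔ c′ ⊔ ℓ₁′ ⊔ ℓ₂′) where
  private
    module k = HeytingField k
    module K = HeytingField K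
    rawRing : ∀ {a b d} → HeytingField a b d → RawRing a b
    rawRing L = CommutativeRing.rawRing
      (HeytingCommutativeRing.commutativeRing (HeytingField.heytingCommutativeRing L))

  field
    ι                 : k.Carrier → K.Carrier
    ι-isHomomorphism  : IsRingHomomorphism (rawRing k) (rawRing K) ι
    x y               : K.Carrier

  -- The j-th entry of the i-th list is the coefficient of xⁱyʲ.
  Polynomial : Set c
  Polynomial = List (List k.Carrier)

  Nonzero : Polynomial → Set (c ⊔ ℓ₂)
  Nonzero = Any (Any (k._# k.0#))

  horner : K.Carrier → List K.Carrier → K.Carrier
  horner u = foldr (λ a r → a K.+ u K.* r) K.0#

  ⟦_⟧₁ : List k.Carrier → K.Carrier
  ⟦ q ⟧₁ = horner y (map ι q)

  ⟦_⟧ : Polynomial → K.Carrier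
  ⟦ p ⟧ = horner x (map ⟦_⟧₁ p)

  -- Independence in its positive form: with ≉ in place of # it would not
  -- constructively yield inverses.
  field
    algebraicallyIndependent : ∀ p → Nonzero p → ⟦ p ⟧ K.# K.0#
    generated : ∀ f → ∃₂ λ p q → Nonzero q × f K.* ⟦ q ⟧ K.≈ ⟦ p ⟧

------------------------------------------------------------------------

module Fibonacci {k : HeytingField c ℓ₁ ℓ₂} {K : HeytingField c′ ℓ₁′ ℓ₂′}
                 (k⟨x,y⟩ : RationalFunctionField k K) where

  open RationalFunctionField k⟨x,y⟩ public
  private
    module k where
      open HeytingField k public
      open Algebra.Apartness.Properties.HeytingCommutativeRing heytingCommutativeRing public
  open HeytingField K public
    using (Carrier; _≈_; _#_; 0#; 1#; -_) renaming (_+_ to _⊹_; _*_ to _·_)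
  open HeytingField K using
    ( heytingCommutativeRing; #⇒invertible; #-sym
    ; refl; sym; trans; setoid; +-cong; +-congˡ; +-congʳ; *-congˡ; *-congʳ
    ; +-identityˡ; +-identityʳ; *-identityʳ; zeroʳ; distribˡ )
  open Algebra.Apartness.Properties.HeytingCommutativeRing heytingCommutativeRing
    using (1#0; x#0y#0→xy#0; x-0≈x; invertibleˡ⇒#; #-congʳ)
  open HeytingCommutativeRing heytingCommutativeRing using (commutativeRing)
  open CommutativeRing commutativeRing
    using (rawRing; +-commutativeSemigroup; *-commutativeSemigroup)
  open RawRing rawRing public using (rawSemiring)
  open Algebra.Definitions.RawSemiring rawSemiring public using (_^_; product)
  open Algebra.Properties.CommutativeSemigroup +-commutativeSemigroup using (interchange)
  open Algebra.Properties.CommutativeSemigroup *-commutativeSemigroup using (x∙yz≈y∙xz)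
  open IsRingHomomorphism ι-isHomomorphism using (⟦⟧-cong; +-homo; 0#-homo; 1#-homo)
  open Relation.Binary.Reasoning.Setoid setoid

  infix 9 inv
  inv : (a : Carrier) → a # 0# → Carrier
  inv a a#0 = proj₁ (#⇒invertible a#0)

  inv-inverseʳ : ∀ a (a#0 : a # 0#) → a · inv a a#0 ≈ 1#
  inv-inverseʳ a a#0 =
    trans (*-congʳ (sym (x-0≈x a))) (proj₂ (proj₂ (#⇒invertible a#0)))

  fib : ℕ → Carrier
  fib 0             = 0#
  fib 1             = 1#
  fib (suc (suc n)) = x · fib (suc n) ⊹ y · fib n

  private
    infixl 6 _+₁_ _+₂_
    _+₁_ : List k.Carrier → List k.Carrier → List k.Carrier
    []      +₁ q       = q
    (a ∷ p) +₁ []      = a ∷ p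
    (a ∷ p) +₁ (b ∷ q) = (a k.+ b) ∷ (p +₁ q)

    _+₂_ : Polynomial → Polynomial → Polynomial
    []      +₂ q       = q
    (a ∷ p) +₂ []      = a ∷ p
    (a ∷ p) +₂ (b ∷ q) = (a +₁ b) ∷ (p +₂ q)

    x*_ y*_ : Polynomial → Polynomial
    x* p = [] ∷ p
    y* p = map (k.0# ∷_) p

    fibPoly : ℕ → Polynomial
    fibPoly 0             = []
    fibPoly 1             = (k.1# ∷ []) ∷ []
    fibPoly (suc (suc n)) = x* fibPoly (suc n) +₂ y* fibPoly n

    horner-step : ∀ a b u r s → (a ⊹ b) ⊹ u · (r ⊹ s) ≈ (a ⊹ u · r) ⊹ (b ⊹ u · s)
    horner-step a b u r s = trans (+-congˡ (distribˡ u r s)) (interchange a b (u · r) (u · s))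

    ⟦+₁⟧ : ∀ p q → ⟦ p +₁ q ⟧₁ ≈ ⟦ p ⟧₁ ⊹ ⟦ q ⟧₁
    ⟦+₁⟧ []      q       = sym (+-identityˡ _)
    ⟦+₁⟧ (a ∷ p) []      = sym (+-identityʳ _)
    ⟦+₁⟧ (a ∷ p) (b ∷ q) =
      trans (+-cong (+-homo a b) (*-congˡ (⟦+₁⟧ p q))) (horner-step _ _ _ _ _)

    ⟦+₂⟧ : ∀ p q → ⟦ p +₂ q ⟧ ≈ ⟦ p ⟧ ⊹ ⟦ q ⟧
    ⟦+₂⟧ []      q       = sym (+-identityˡ _)
    ⟦+₂⟧ (a ∷ p) []      = sym (+-identityʳ _)
    ⟦+₂⟧ (a ∷ p) (b ∷ q) =
      trans (+-cong (⟦+₁⟧ a b) (*-congˡ (⟦+₂⟧ p q))) (horner-step _ _ _ _ _)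

    ⟦x*⟧ : ∀ p → ⟦ x* p ⟧ ≈ x · ⟦ p ⟧
    ⟦x*⟧ p = +-identityˡ _

    ⟦y*⟧ : ∀ p → ⟦ y* p ⟧ ≈ y · ⟦ p ⟧
    ⟦y*⟧ []      = sym (zeroʳ y)
    ⟦y*⟧ (a ∷ p) = begin
      (ι k.0# ⊹ y · ⟦ a ⟧₁) ⊹ x · ⟦ y* p ⟧
        ≈⟨ +-cong (trans (+-congʳ 0#-homo) (+-identityˡ _)) (*-congˡ (⟦y*⟧ p)) ⟩
      y · ⟦ a ⟧₁ ⊹ x · (y · ⟦ p ⟧)
        ≈⟨ +-congˡ (x∙yz≈y∙xz x y _) ⟩
      y · ⟦ a ⟧₁ ⊹ y · (x · ⟦ p ⟧)
        ≈⟨ distribˡ y _ _ ⟨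
      y · (⟦ a ⟧₁ ⊹ x · ⟦ p ⟧) ∎

    ⟦fibPoly⟧ : ∀ n → ⟦ fibPoly n ⟧ ≈ fib n
    ⟦fibPoly⟧ 0 = refl
    ⟦fibPoly⟧ 1 = begin
      (ι k.1# ⊹ y · 0#) ⊹ x · 0# ≈⟨ +-cong (+-congˡ (zeroʳ y)) (zeroʳ x) ⟩
      (ι k.1# ⊹ 0#) ⊹ 0#         ≈⟨ +-identityʳ _ ⟩
      ι k.1# ⊹ 0#                ≈⟨ +-identityʳ _ ⟩
      ι k.1#                     ≈⟨ 1#-homo ⟩
      1#                         ∎
    ⟦fibPoly⟧ (suc (suc n)) =
      trans (⟦+₂⟧ (x* fibPoly (suc n)) (y* fibPoly n))
        (+-cong (trans (⟦x*⟧ (fibPoly (suc n))) (*-congˡ (⟦fibPoly⟧ (suc n))))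
                (trans (⟦y*⟧ (fibPoly n)) (*-congˡ (⟦fibPoly⟧ n))))

    data StartsWith (r : k.Carrier) : List k.Carrier → Set (c ⊔ ℓ₁) where
      head : ∀ {a q} → a k.≈ r → StartsWith r (a ∷ q)

    y*-head : ∀ p → All (StartsWith k.0#) (y* p)
    y*-head []      = []
    y*-head (a ∷ p) = head k.refl ∷ y*-head p

    +₂-head : ∀ {p q} → Any (StartsWith k.1#) p → All (StartsWith k.0#) q →
               Any (StartsWith k.1#) (p +₂ q)
    +₂-head {_ ∷ _} h               []            = h
    +₂-head {_ ∷ _} (here (head e)) (head e′ ∷ _) =
      here (head (k.trans (k.+-cong e e′) (k.+-identityʳ k.1#)))
    +₂-head {_ ∷ _} (there h)       (_ ∷ zs)      = there (+₂-head h zs)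

    fibPoly-head : ∀ n → Any (StartsWith k.1#) (fibPoly (suc n))
    fibPoly-head zero    = here (head k.refl)
    fibPoly-head (suc n) = +₂-head (there (fibPoly-head n)) (y*-head (fibPoly n))

    fibPoly-nonzero : ∀ n → Nonzero (fibPoly (suc n))
    fibPoly-nonzero n = Any.map
      (λ { (head e) → here (k.#-congʳ (k.sym e) k.1#0) }) (fibPoly-head n)

  fib#0 : ∀ n .{{_ : NonZero n}} → fib n # 0#
  fib#0 zero {{n≢0}} = ⊥-elim (NonZero.nonZero n≢0)
  fib#0 (suc n) = #-congʳ (⟦fibPoly⟧ (suc n))
    (algebraicallyIndependent (fibPoly (suc n)) (fibPoly-nonzero n))

  y#0 : y # 0#
  y#0 = #-congʳ ⟦y⟧ (algebraicallyIndependent ((k.0# ∷ k.1# ∷ []) ∷ []) (here (there (here k.1#0))))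
    where
    ⟦y⟧ : ⟦ (k.0# ∷ k.1# ∷ []) ∷ [] ⟧ ≈ y
    ⟦y⟧ = begin
      (ι k.0# ⊹ y · (ι k.1# ⊹ y · 0#)) ⊹ x · 0#
        ≈⟨ trans (+-congˡ (zeroʳ x)) (+-identityʳ _) ⟩
      ι k.0# ⊹ y · (ι k.1# ⊹ y · 0#)
        ≈⟨ trans (+-congʳ 0#-homo) (+-identityˡ _) ⟩
      y · (ι k.1# ⊹ y · 0#)
        ≈⟨ *-congˡ (trans (+-cong 1#-homo (zeroʳ y)) (+-identityʳ 1#)) ⟩
      y · 1#
        ≈⟨ *-identityʳ y ⟩
      y ∎

  -y#0 : (- y) # 0#
  -y#0 with #⇒invertible (#-sym y#0)
  ... | u , u[0-y]≈1 , _ =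
    invertibleˡ⇒# (u , trans (*-congˡ (trans (x-0≈x (- y)) (sym (+-identityˡ (- y))))) u[0-y]≈1)

  ^#0 : ∀ {a} → a # 0# → ∀ n → a ^ n # 0#
  ^#0 a#0 zero    = 1#0
  ^#0 a#0 (suc n) = x#0y#0→xy#0 a#0 (^#0 a#0 n)

  product#0 : ∀ {n} (f : Fin n → Carrier) → (∀ i → f i # 0#) → product f # 0#
  product#0 {zero}  f f#0 = 1#0
  product#0 {suc n} f f#0 =
    x#0y#0→xy#0 (f#0 Fin.zero) (product#0 (f ∘ Fin.suc) (f#0 ∘ Fin.suc))

  F : ℤ → Carrier
  F (+ n)    = fib n
  F -[1+ n ] = - (inv ((- y) ^ suc n) (^#0 -y#0 (suc n)) · fib (suc n))

  -- The subtraction n ∸ i is exact if k ≤ n.  If k > n, then the factor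
  -- at i = n is F₀ = 0, as it should be.
  fibonom : (s : ℕ) .{{_ : NonZero s}} → ℕ → ℕ → Carrier
  fibonom s n k =
    product {k} (λ i → F (+ (s ℕ.* (n ∸ toℕ i)))) · inv (product denominators) denominators#0
    where
    denominators : Fin k → Carrier
    denominators i = F (+ (suc (toℕ i) ℕ.* s))
    denominators#0 : product denominators # 0#
    denominators#0 = product#0 denominators
      (λ i → fib#0 (suc (toℕ i) ℕ.* s) {{ℕ.m*n≢0 (suc (toℕ i)) s}})

  open LaurentSeries rawSemiring public
  open RangeSum laurentRawSemiring public

{-# OPTIONS --safe #-}

-- Over a ring containing the roots α, β of t² = xt + y, the sequence (α-β)² F(t₁sn+m₁) F(t₂sn+m₂)
-- is a linear combination of the geometric sequences with ratios αˢⁱ βˢʲ, i + j = t₁ + t₂.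
-- Since F(m+n) = αᵐ F(n) + βⁿ F(m), the s-Fibopolynomials satisfy the Pascal rule of the
-- Gaussian binomials in αˢ, βˢ, so by the q-binomial theorem the denominator is, up to the sign
-- (-1)ˢ⁺¹, the polynomial in z with exactly these roots: its coefficients are those of a linear
-- recurrence for the sequence. The numerator is what is left of the product of
-- the denominator and the Z transform.
module Submission where

open import Defs
open import Algebra.Apartness.Bundles using (HeytingField; HeytingCommutativeRing)
open import Algebra.Bundles using (CommutativeRing)
open import Algebra.Bundles.Raw using (RawRing)
open import Algebra.Definitions.RawSemiring using (sum)
open import Algebra.Morphism.Structures using (IsRingHomomorphism; IsRingMonomorphism)
open import Data.Fin.Base as Fin using (Fin; toℕ)
open import Data.Integer.Base using (ℤ; +_; -[1+_]) renaming (_+_ to _+ℤ_)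
open import Data.List.Base using ([]; _∷_)
open import Data.List.Relation.Unary.Any using (here; there)
open import Data.Nat.Base using (ℕ; zero; suc; _+_; _*_; _∸_; _≤_; z≤n; s≤s; NonZero)
open import Data.Nat.DivMod using (_/_; m*n/n≡m)
open import Data.Product.Base using (∃₂; _,_; proj₁; proj₂; _×_)
open import Data.Sum.Base using (inj₁; inj₂)
open import Function.Base using (_∘_)
open import Level using (_⊔_) renaming (suc to lsuc)
open import Relation.Binary.PropositionalEquality.Core as ≡ using (_≡_)
import Algebra.Apartness.Properties.HeytingCommutativeRing
import Algebra.Construct.DirectProduct
import Algebra.Properties.CommutativeSemigroup
import Algebra.Properties.CommutativeSemiring.Exp
import Algebra.Properties.Ring
import Algebra.Properties.Semiring.Sum
import Algebra.Solver.Ring.NaturalCoefficients.Default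
import Data.Fin.Properties as Fin
import Data.Integer.Properties as ℤ
import Data.Nat.Properties as ℕ
import Data.Nat.Solver
import Relation.Binary.PropositionalEquality.Properties as ≡
import Relation.Binary.Reasoning.Setoid

-- The roots α and β do not lie in K, and a splitting field would have to come with its own
-- apartness and inverses. The proof therefore uses the commutative ring K[t]/(t² - xt - y), into
-- which K embeds, and lets only elements of K be divided by: the denominators of the
-- s-Fibopolynomials and x² + 4y. Binet's formula occurs only multiplied by α - β. A product of two
-- Fibonacci factors needs this multiplier twice, and (α - β)² = x² + 4y is an element of K apart
-- from 0, so it can be cancelled there. The signs have one source: αβ = -y. The weight
-- (αβ)^(sj(j-1)/2) of the q-binomial theorem contributes (-1)^(sj(j-1)/2) y^(sj(j-1)/2); the
-- alternating (-1)^j and the overall (-1)^(s+1) account for the rest of the exponent of -1, up to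
-- an even number.

-- Finite sums

module FiniteSums {c ℓ} (R : CommutativeRing c ℓ) where
  open CommutativeRing R renaming (_+_ to _⊹_; _*_ to _·_)
  open RangeSum (RawRing.rawSemiring rawRing) public
  open Algebra.Properties.Semiring.Sum semiring using (*-distribˡ-sum; ∑-distrib-+)
  open Relation.Binary.Reasoning.Setoid setoid

  ∑-cong : ∀ n {f g : ℕ → Carrier} → (∀ i → i ≤ n → f i ≈ g i) → ∑≤ n f ≈ ∑≤ n g
  ∑-cong zero    f≈g = +-congʳ (f≈g 0 z≤n)
  ∑-cong (suc n) f≈g = +-cong (f≈g 0 z≤n) (∑-cong n (λ i i≤n → f≈g (suc i) (s≤s i≤n)))

  ∑-+ : ∀ n f g → (∑[ i ≤ n ] (f i ⊹ g i)) ≈ ∑≤ n f ⊹ ∑≤ n g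
  ∑-+ n f g = ∑-distrib-+ {suc n} (f ∘ toℕ) (g ∘ toℕ)

  *-∑ : ∀ n r f → r · ∑≤ n f ≈ (∑[ i ≤ n ] (r · f i))
  *-∑ n r f = *-distribˡ-sum r (f ∘ toℕ {suc n})

  ∑-zero : ∀ n → (∑[ i ≤ n ] 0#) ≈ 0#
  ∑-zero n = trans (∑-cong n (λ _ _ → sym (zeroˡ 0#)))
    (trans (sym (*-∑ n 0# (λ _ → 0#))) (zeroˡ _))

  ∑-last : ∀ n f → ∑≤ (suc n) f ≈ ∑≤ n f ⊹ f (suc n)
  ∑-last zero    f = trans (+-congˡ (+-identityʳ _)) (+-congʳ (sym (+-identityʳ _)))
  ∑-last (suc n) f = trans (+-congˡ (∑-last n (f ∘ suc))) (sym (+-assoc _ _ _))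

-- Convolution, division and truncation of power series

module PowerSeries {c ℓ} (R : CommutativeRing c ℓ) where
  open CommutativeRing R renaming (_+_ to _⊹_; _*_ to _·_)
  open FiniteSums R
  open LaurentSeries (RawRing.rawSemiring rawRing)
  open Relation.Binary.Reasoning.Setoid setoid

  Series : Set c
  Series = ℕ → Carrier

  infix 4 _≋_
  _≋_ : Series → Series → Set ℓ
  a ≋ b = ∀ n → a n ≈ b n

  infixl 7 _⋆_
  _⋆_ : Series → Series → Series
  (a ⋆ b) n = ∑[ i ≤ n ] (a i · b (n ∸ i))

  tail : Series → Series
  tail a = a ∘ suc

  monomial₀ : Carrier → Series
  monomial₀ r zero    = r
  monomial₀ r (suc _) = 0#

  ⋆-cong : ∀ {a a′ b b′} → a ≋ a′ → b ≋ b′ → a ⋆ b ≋ a′ ⋆ b′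
  ⋆-cong a≋a′ b≋b′ n = ∑-cong n (λ i _ → *-cong (a≋a′ i) (b≋b′ (n ∸ i)))

  -- By definition a convolution unfolds at its first summand. Unfolding it at the last one instead
  -- makes commutativity and long division accessible to induction on the index.
  ⋆-suc : ∀ a b n → (a ⋆ b) (suc n) ≈ (a ⋆ tail b) n ⊹ a (suc n) · b 0
  ⋆-suc a b zero    = trans (+-congˡ (+-identityʳ _)) (+-congʳ (sym (+-identityʳ _)))
  ⋆-suc a b (suc n) = trans (+-congˡ (⋆-suc (tail a) b n)) (sym (+-assoc _ _ _))

  ⋆-comm : ∀ a b → a ⋆ b ≋ b ⋆ a
  ⋆-comm a b zero    = +-congʳ (*-comm _ _)
  ⋆-comm a b (suc n) = begin
    a 0 · b (suc n) ⊹ (tail a ⋆ b) n ≈⟨ +-comm _ _ ⟩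
    (tail a ⋆ b) n ⊹ a 0 · b (suc n) ≈⟨ +-cong (⋆-comm (tail a) b n) (*-comm _ _) ⟩
    (b ⋆ tail a) n ⊹ b (suc n) · a 0 ≈⟨ ⋆-suc b a n ⟨
    (b ⋆ a) (suc n)                  ∎

  ⋆-distribʳ-+ : ∀ a b c → (λ i → a i ⊹ b i) ⋆ c ≋ (λ i → (a ⋆ c) i ⊹ (b ⋆ c) i)
  ⋆-distribʳ-+ a b c n =
    trans (∑-cong n (λ i _ → distribʳ (c (n ∸ i)) (a i) (b i)))
          (∑-+ n (λ i → a i · c (n ∸ i)) (λ i → b i · c (n ∸ i)))

  scale-⋆ : ∀ r a b → (λ i → r · a i) ⋆ b ≋ (λ i → r · (a ⋆ b) i)
  scale-⋆ r a b n = trans (∑-cong n (λ i _ → *-assoc r (a i) (b (n ∸ i))))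
                          (sym (*-∑ n r (λ i → a i · b (n ∸ i))))

  ⋆-assoc : ∀ a b c → (a ⋆ b) ⋆ c ≋ a ⋆ (b ⋆ c)
  ⋆-assoc a b c zero    = +-congʳ (begin
    (a 0 · b 0 ⊹ 0#) · c 0 ≈⟨ *-congʳ (+-identityʳ _) ⟩
    a 0 · b 0 · c 0        ≈⟨ *-assoc _ _ _ ⟩
    a 0 · (b 0 · c 0)      ≈⟨ *-congˡ (+-identityʳ _) ⟨
    a 0 · (b 0 · c 0 ⊹ 0#) ∎)
  ⋆-assoc a b c (suc n) = begin
    (a 0 · b 0 ⊹ 0#) · c (suc n) ⊹ (tail (a ⋆ b) ⋆ c) n
      ≈⟨ +-cong (trans (*-congʳ (+-identityʳ _)) (*-assoc _ _ _)) (begin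
           (tail (a ⋆ b) ⋆ c) n
             ≈⟨ ⋆-distribʳ-+ (λ i → a 0 · b (suc i)) (tail a ⋆ b) c n ⟩
           ((λ i → a 0 · b (suc i)) ⋆ c) n ⊹ ((tail a ⋆ b) ⋆ c) n
             ≈⟨ +-cong (scale-⋆ (a 0) (tail b) c n) (⋆-assoc (tail a) b c n) ⟩
           a 0 · (tail b ⋆ c) n ⊹ (tail a ⋆ (b ⋆ c)) n ∎) ⟩
    a 0 · (b 0 · c (suc n)) ⊹ (a 0 · (tail b ⋆ c) n ⊹ (tail a ⋆ (b ⋆ c)) n)
      ≈⟨ +-assoc _ _ _ ⟨
    (a 0 · (b 0 · c (suc n)) ⊹ a 0 · (tail b ⋆ c) n) ⊹ (tail a ⋆ (b ⋆ c)) n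
      ≈⟨ +-congʳ (distribˡ _ _ _) ⟨
    (a ⋆ (b ⋆ c)) (suc n) ∎

  zeroˡ-⋆ : ∀ a → (λ _ → 0#) ⋆ a ≋ (λ _ → 0#)
  zeroˡ-⋆ a n = trans (∑-cong n (λ i _ → zeroˡ (a (n ∸ i)))) (∑-zero n)

  ⋆-identityˡ : ∀ a → monomial₀ 1# ⋆ a ≋ a
  ⋆-identityˡ a zero    = trans (+-identityʳ _) (*-identityˡ _)
  ⋆-identityˡ a (suc n) = trans (+-cong (*-identityˡ _) (zeroˡ-⋆ a n)) (+-identityʳ _)

  -- Long division, one coefficient at a time.
  quotient : (u : Carrier) → Series → Series → Series
  quotient u c r zero    = u · r 0
  quotient u c r (suc n) = quotient u c (λ i → r (suc i) - c (suc i) · (u · r 0)) n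

  -- By `⋆-suc`, the tail of the quotient has to be the quotient of the remainder `r′`, which is the
  -- recursive call in `quotient`.
  ⋆-quotient : ∀ {u} {c : Series} → u · c 0 ≈ 1# → ∀ r → c ⋆ quotient u c r ≋ r
  ⋆-quotient {u} {c} uc₀≈1 r zero = begin
    c 0 · (u · r 0) ⊹ 0# ≈⟨ +-identityʳ _ ⟩
    c 0 · (u · r 0)      ≈⟨ *-assoc _ _ _ ⟨
    c 0 · u · r 0        ≈⟨ *-congʳ (trans (*-comm _ _) uc₀≈1) ⟩
    1# · r 0             ≈⟨ *-identityˡ _ ⟩
    r 0                  ∎
  ⋆-quotient {u} {c} uc₀≈1 r (suc n) = begin
    (c ⋆ quotient u c r) (suc n)        ≈⟨ ⋆-suc c (quotient u c r) n ⟩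
    (c ⋆ quotient u c r′) n ⊹ t         ≈⟨ +-congʳ (⋆-quotient uc₀≈1 r′ n) ⟩
    (r (suc n) - t) ⊹ t                 ≈⟨ +-assoc _ _ _ ⟩
    r (suc n) ⊹ (- t ⊹ t)               ≈⟨ +-congˡ (-‿inverseˡ t) ⟩
    r (suc n) ⊹ 0#                      ≈⟨ +-identityʳ _ ⟩
    r (suc n)                           ∎
    where
    t  = c (suc n) · (u · r 0)
    r′ : Series
    r′ i = r (suc i) - c (suc i) · (u · r 0)

  shift-cong : ∀ e {a b} → a ≋ b → shift e a ≋ shift e b
  shift-cong zero    a≋b n       = a≋b n
  shift-cong (suc e) a≋b zero    = refl
  shift-cong (suc e) a≋b (suc n) = shift-cong e a≋b n

  shift-shift : ∀ d e a → shift d (shift e a) ≋ shift (d + e) a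
  shift-shift zero    e a n       = refl
  shift-shift (suc d) e a zero    = refl
  shift-shift (suc d) e a (suc n) = shift-shift d e a n

  shift-≡ : ∀ {d e} → d ≡ e → ∀ a → shift d a ≋ shift e a
  shift-≡ ≡.refl a n = refl

  shift-comm : ∀ d e a → shift d (shift e a) ≋ shift e (shift d a)
  shift-comm d e a n = begin
    shift d (shift e a) n ≈⟨ shift-shift d e a n ⟩
    shift (d + e) a n     ≈⟨ shift-≡ (ℕ.+-comm d e) a n ⟩
    shift (e + d) a n     ≈⟨ shift-shift e d a n ⟨
    shift e (shift d a) n ∎

  shift-+ : ∀ e a b → shift e (λ n → a n ⊹ b n) ≋ (λ n → shift e a n ⊹ shift e b n)
  shift-+ zero    a b n       = refl
  shift-+ (suc e) a b zero    = sym (+-identityˡ 0#)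
  shift-+ (suc e) a b (suc n) = shift-+ e a b n

  shift-0 : ∀ e → shift e (λ _ → 0#) ≋ (λ _ → 0#)
  shift-0 zero    n       = refl
  shift-0 (suc e) zero    = refl
  shift-0 (suc e) (suc n) = shift-0 e n

  shift-⋆ : ∀ e a b → shift e a ⋆ b ≋ shift e (a ⋆ b)
  shift-⋆ zero    a b n       = refl
  shift-⋆ (suc e) a b zero    = trans (+-identityʳ _) (zeroˡ _)
  shift-⋆ (suc e) a b (suc n) =
    trans (+-cong (zeroˡ _) (shift-⋆ e a b n)) (+-identityˡ _)

  ⋆-shift : ∀ e a b → a ⋆ shift e b ≋ shift e (a ⋆ b)
  ⋆-shift e a b n = begin
    (a ⋆ shift e b) n  ≈⟨ ⋆-comm a (shift e b) n ⟩
    (shift e b ⋆ a) n  ≈⟨ shift-⋆ e b a n ⟩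
    shift e (b ⋆ a) n  ≈⟨ shift-cong e (⋆-comm b a) n ⟩
    shift e (a ⋆ b) n  ∎

  truncate : ℕ → Series → Series
  truncate _       a zero    = a 0
  truncate zero    a (suc n) = 0#
  truncate (suc N) a (suc n) = truncate N (tail a) n

  ∑-monomials : ∀ N (a : Series) n →
                (∑[ i ≤ N ] shift i (monomial₀ (a i)) n) ≈ truncate N a n
  ∑-monomials zero    a zero    = +-identityʳ _
  ∑-monomials zero    a (suc n) = +-identityʳ _
  ∑-monomials (suc N) a zero    = trans (+-congˡ (∑-zero N)) (+-identityʳ _)
  ∑-monomials (suc N) a (suc n) = trans (+-identityˡ _) (∑-monomials N (tail a) n)

  truncate-low : ∀ N a {n} → n ≤ N → truncate N a n ≈ a n
  truncate-low N       a z≤n       = refl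
  truncate-low (suc N) a (s≤s n≤N) = truncate-low N (tail a) n≤N

  truncate-high : ∀ N a k → truncate N a (suc N + k) ≈ 0#
  truncate-high zero    a k = refl
  truncate-high (suc N) a k = truncate-high N (tail a) k

  truncate-⋆-low : ∀ N a b {n} → n ≤ N → (truncate N a ⋆ b) n ≈ (a ⋆ b) n
  truncate-⋆-low N a b {n} n≤N =
    ∑-cong n (λ i i≤n → *-congʳ {b (n ∸ i)} (truncate-low N a (ℕ.≤-trans i≤n n≤N)))

  -- From index `N` on the number of summands is constant: a coefficient of the product is the left
  -- side of a linear recurrence of order `N`.
  truncate-⋆-high : ∀ N a b k →
    (truncate N a ⋆ b) (N + k) ≈ (∑[ i ≤ N ] (a i · b (N + k ∸ i)))
  truncate-⋆-high zero    a b zero    = refl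
  truncate-⋆-high zero    a b (suc k) = +-congˡ (zeroˡ-⋆ b k)
  truncate-⋆-high (suc N) a b k       = +-congˡ (truncate-⋆-high N (tail a) b k)

-- Polynomials in z as Laurent series, and their quotients

module LaurentQuotients {c ℓ} (R : CommutativeRing c ℓ) where
  open CommutativeRing R renaming (_+_ to _⊹_; _*_ to _·_)
  open FiniteSums R
  open PowerSeries R
  open LaurentSeries (RawRing.rawSemiring rawRing)
  module ∑ᴸ = RangeSum laurentRawSemiring
  open Relation.Binary.Reasoning.Setoid setoid

  z^-coeff : ∀ r d → Laurent.coeff (r z^ d) ≋ monomial₀ r
  z^-coeff r d zero    = refl
  z^-coeff r d (suc n) = refl

  z^-≈ᴸ : ∀ r {N i} → i ≤ N → (r z^ (N ∸ i)) ≈ᴸ ⟨ N , shift i (monomial₀ r) ⟩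
  z^-≈ᴸ r {N} {i} i≤N n = begin
    shift N (Laurent.coeff (r z^ (N ∸ i))) n  ≈⟨ shift-cong N (z^-coeff r (N ∸ i)) n ⟩
    shift N (monomial₀ r) n                   ≈⟨ shift-≡ (ℕ.m∸n+n≡m i≤N) (monomial₀ r) n ⟨
    shift (N ∸ i + i) (monomial₀ r) n         ≈⟨ shift-shift (N ∸ i) i (monomial₀ r) n ⟨
    shift (N ∸ i) (shift i (monomial₀ r)) n   ∎

  -- The operation `_+ᴸ_` adds the orders of its arguments, so iterated sums acquire many leading
  -- zeros. Comparing every summand with a series of the same order `N` keeps the order under
  -- control.
  +ᴸ-≈ᴸ : ∀ f g {N a b} → f ≈ᴸ ⟨ N , a ⟩ → g ≈ᴸ ⟨ N , b ⟩ →
          f +ᴸ g ≈ᴸ ⟨ N , (λ n → a n ⊹ b n) ⟩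
  +ᴸ-≈ᴸ ⟨ d , a′ ⟩ ⟨ e , b′ ⟩ {N} {a} {b} f≈ g≈ n = begin
    shift N (λ k → shift e a′ k ⊹ shift d b′ k) n
      ≈⟨ shift-+ N (shift e a′) (shift d b′) n ⟩
    shift N (shift e a′) n ⊹ shift N (shift d b′) n
      ≈⟨ +-cong (shift-comm N e a′ n) (shift-comm N d b′ n) ⟩
    shift e (shift N a′) n ⊹ shift d (shift N b′) n
      ≈⟨ +-cong (shift-cong e f≈ n) (shift-cong d g≈ n) ⟩
    shift e (shift d a) n ⊹ shift d (shift e b) n
      ≈⟨ +-cong (shift-comm e d a n) refl ⟩
    shift d (shift e a) n ⊹ shift d (shift e b) n
      ≈⟨ +-cong (shift-shift d e a n) (shift-shift d e b n) ⟩
    shift (d + e) a n ⊹ shift (d + e) b n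
      ≈⟨ shift-+ (d + e) a b n ⟨
    shift (d + e) (λ k → a k ⊹ b k) n ∎

  sum-≈ᴸ : ∀ {m N} (f : Fin m → Laurent) (a : Fin m → Series) →
           (∀ i → f i ≈ᴸ ⟨ N , a i ⟩) →
           sum laurentRawSemiring f ≈ᴸ
             ⟨ N , (λ n → sum (RawRing.rawSemiring rawRing) (λ i → a i n)) ⟩
  sum-≈ᴸ {zero}  {N} f a f≈a n =
    trans (shift-cong N (λ { zero → refl ; (suc _) → refl }) n) (shift-0 N n)
  sum-≈ᴸ {suc m} {N} f a f≈a =
    +ᴸ-≈ᴸ (f Fin.zero) _ {N} {a Fin.zero} (f≈a Fin.zero)
      (sum-≈ᴸ {m} {N} (f ∘ Fin.suc) (a ∘ Fin.suc) (f≈a ∘ Fin.suc))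

  ∑ᴸ-≈ᴸ : ∀ m {N} (f : ℕ → Laurent) (a : ℕ → Series) →
          (∀ i → i ≤ m → f i ≈ᴸ ⟨ N , a i ⟩) →
          ∑ᴸ.∑≤ m f ≈ᴸ ⟨ N , (λ n → ∑[ i ≤ m ] a i n) ⟩
  ∑ᴸ-≈ᴸ m {N} f a f≈a =
    sum-≈ᴸ {suc m} {N} (f ∘ toℕ) (a ∘ toℕ) (λ i → f≈a (toℕ i) (Fin.toℕ≤pred[n] i))

  ≈ᴸ-coeff : ∀ f {N a b} → a ≋ b → f ≈ᴸ ⟨ N , a ⟩ → f ≈ᴸ ⟨ N , b ⟩
  ≈ᴸ-coeff f a≋b f≈ n = trans (f≈ n) (shift-cong (Laurent.order f) a≋b n)

  shift-monomial₀-∑ : ∀ e m (r : ℕ → Carrier) n →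
    (∑[ j ≤ m ] shift e (monomial₀ (r j)) n) ≈ shift e (monomial₀ (∑≤ m r)) n
  shift-monomial₀-∑ zero    m r zero    = refl
  shift-monomial₀-∑ zero    m r (suc n) = ∑-zero m
  shift-monomial₀-∑ (suc e) m r zero    = ∑-zero m
  shift-monomial₀-∑ (suc e) m r (suc n) = shift-monomial₀-∑ e m r n

  polynomial-≈ᴸ : ∀ N (a : ℕ → Carrier) →
                  (∑ᴸ.∑≤ N (λ i → a i z^ (N ∸ i))) ≈ᴸ ⟨ N , truncate N a ⟩
  polynomial-≈ᴸ N a = ≈ᴸ-coeff (∑ᴸ.∑≤ N term) {N} (∑-monomials N a)
    (∑ᴸ-≈ᴸ N {N} term (λ i → shift i (monomial₀ (a i))) (λ i i≤N → z^-≈ᴸ (a i) i≤N))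
    where
    term : ℕ → Laurent
    term i = a i z^ (N ∸ i)

  polynomial₂-≈ᴸ : ∀ N (a : ℕ → ℕ → Carrier) →
    (∑ᴸ.∑≤ N (λ i → ∑ᴸ.∑≤ i (λ j → a i j z^ (N ∸ i)))) ≈ᴸ
      ⟨ N , truncate N (λ i → ∑≤ i (a i)) ⟩
  polynomial₂-≈ᴸ N a =
    ≈ᴸ-coeff (∑ᴸ.∑≤ N (λ i → ∑ᴸ.∑≤ i (term i))) {N} (∑-monomials N (λ i → ∑≤ i (a i)))
      (∑ᴸ-≈ᴸ N {N} (λ i → ∑ᴸ.∑≤ i (term i)) (λ i → shift i (monomial₀ (∑≤ i (a i)))) (λ i i≤N →
        ≈ᴸ-coeff (∑ᴸ.∑≤ i (term i)) {N} (shift-monomial₀-∑ i i (a i))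
          (∑ᴸ-≈ᴸ i {N} (term i) (λ j → shift i (monomial₀ (a i j))) (λ j _ → z^-≈ᴸ (a i j) i≤N))))
    where
    term : ℕ → ℕ → Laurent
    term i j = a i j z^ (N ∸ i)

  -- Here g = z^T e and h = z^(T+1) d with `d 0` a unit, so h has the inverse z^-(T+1) / d, and the
  -- claim reduces to the identity d a = e of power series.
  ≐÷-intro : ∀ (a d e : Series) {u} N T g h → N ≡ suc T → u · d 0 ≈ 1# →
             g ≈ᴸ ⟨ T , e ⟩ → h ≈ᴸ ⟨ N , d ⟩ → d ⋆ a ≋ e → 𝒵 a ≐ z *ᴸ g ÷ h
  ≐÷-intro a d e {u} .(suc T) T g@(⟨ G , γ ⟩) h@(⟨ H , η ⟩) ≡.refl ud₀≈1 g≈ h≈ d⋆a≋e =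
    (h⁻¹ , h⁻¹*h≈1 , h*h⁻¹≈1) , 𝒵a≈zg*h⁻¹
    where
    v : Series
    v = quotient u d (monomial₀ 1#)

    v⋆d : v ⋆ d ≋ monomial₀ 1#
    v⋆d n = trans (⋆-comm v d n) (⋆-quotient ud₀≈1 (monomial₀ 1#) n)

    h⁻¹ : Laurent
    h⁻¹ = ⟨ 0 , shift (suc T) v ⟩

    product-coeff : η ⋆ shift (suc T) v ≋ shift H (monomial₀ 1#)
    product-coeff n = begin
      (η ⋆ shift (suc T) v) n  ≈⟨ ⋆-shift (suc T) η v n ⟩
      shift (suc T) (η ⋆ v) n  ≈⟨ shift-⋆ (suc T) η v n ⟨
      (shift (suc T) η ⋆ v) n  ≈⟨ ⋆-cong {b = v} h≈ (λ _ → refl) n ⟩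
      (shift H d ⋆ v) n        ≈⟨ shift-⋆ H d v n ⟩
      shift H (d ⋆ v) n        ≈⟨ shift-cong H (⋆-quotient ud₀≈1 (monomial₀ 1#)) n ⟩
      shift H (monomial₀ 1#) n ∎

    h*h⁻¹≈1 : h *ᴸ h⁻¹ ≈ᴸ 1ᴸ
    h*h⁻¹≈1 n = begin
      (η ⋆ shift (suc T) v) n                  ≈⟨ product-coeff n ⟩
      shift H (monomial₀ 1#) n                 ≈⟨ shift-≡ (ℕ.+-identityʳ H) (monomial₀ 1#) n ⟨
      shift (H + 0) (monomial₀ 1#) n           ≈⟨ shift-cong (H + 0) (z^-coeff 1# 0) n ⟨
      shift (H + 0) (Laurent.coeff 1ᴸ) n       ∎

    h⁻¹*h≈1 : h⁻¹ *ᴸ h ≈ᴸ 1ᴸ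
    h⁻¹*h≈1 n = begin
      (shift (suc T) v ⋆ η) n        ≈⟨ ⋆-comm (shift (suc T) v) η n ⟩
      (η ⋆ shift (suc T) v) n        ≈⟨ product-coeff n ⟩
      shift H (monomial₀ 1#) n       ≈⟨ shift-cong H (z^-coeff 1# 0) n ⟨
      shift H (Laurent.coeff 1ᴸ) n   ∎

    e⋆v : e ⋆ v ≋ a
    e⋆v n = begin
      (e ⋆ v) n        ≈⟨ ⋆-cong {b = v} d⋆a≋e (λ _ → refl) n ⟨
      (d ⋆ a ⋆ v) n    ≈⟨ ⋆-comm (d ⋆ a) v n ⟩
      (v ⋆ (d ⋆ a)) n  ≈⟨ ⋆-assoc v d a n ⟨
      (v ⋆ d ⋆ a) n    ≈⟨ ⋆-cong {b = a} v⋆d (λ _ → refl) n ⟩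
      (monomial₀ 1# ⋆ a) n ≈⟨ ⋆-identityˡ a n ⟩
      a n              ∎

    zγ : Laurent.coeff z ⋆ γ ≋ γ
    zγ n = trans (⋆-cong {b = γ} (z^-coeff 1# 1) (λ _ → refl) n) (⋆-identityˡ γ n)

    𝒵a≈zg*h⁻¹ : 𝒵 a ≈ᴸ (z *ᴸ g) *ᴸ h⁻¹
    𝒵a≈zg*h⁻¹ n = sym (begin
      (Laurent.coeff z ⋆ γ ⋆ shift (suc T) v) n ≈⟨ ⋆-cong {b = shift (suc T) v} zγ (λ _ → refl) n ⟩
      (γ ⋆ shift (suc T) v) n                   ≈⟨ ⋆-shift (suc T) γ v n ⟩
      shift (1 + T) (γ ⋆ v) n                   ≈⟨ shift-shift 1 T (γ ⋆ v) n ⟨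
      -- Of the T + 1 shifts in `h⁻¹`, T are offset by the order of `g` and the remaining one by the
      -- factor `z`.
      shift 1 (shift T (γ ⋆ v)) n               ≈⟨ shift-cong 1 (shift-⋆ T γ v) n ⟨
      shift 1 (shift T γ ⋆ v) n                 ≈⟨ shift-cong 1 (⋆-cong {b = v} g≈ (λ _ → refl)) n ⟩
      shift 1 (shift G e ⋆ v) n                 ≈⟨ shift-cong 1 (shift-⋆ G e v) n ⟩
      shift 1 (shift G (e ⋆ v)) n               ≈⟨ shift-cong 1 (shift-cong G e⋆v) n ⟩
      shift 1 (shift G a) n                     ≈⟨ shift-shift 1 G a n ⟩
      shift (1 + G) a n                         ≈⟨ shift-≡ (ℕ.+-identityʳ (1 + G)) a n ⟨
      shift (1 + G + 0) a n                     ∎)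

  𝒵-recurrence : ∀ N T (a d : Series) {u} (e : ℕ → ℕ → Carrier) → N ≡ suc T → u · d 0 ≈ 1# →
    (∀ k → (∑[ j ≤ N ] (d j · a (N + k ∸ j))) ≈ 0#) →
    (∀ i j → d j · a (i ∸ j) ≈ e i j) →
    𝒵 a ≐ z *ᴸ (∑ᴸ.∑≤ T (λ i → ∑ᴸ.∑≤ i (λ j → e i j z^ (T ∸ i))))
        ÷ (∑ᴸ.∑≤ N (λ i → d i z^ (N ∸ i)))
  𝒵-recurrence .(suc T) T a d e ≡.refl ud₀≈1 d⊥a da≈e =
    ≐÷-intro a (truncate N d) (truncate T ê) N T _ _ ≡.refl ud₀≈1
      (polynomial₂-≈ᴸ T e) (polynomial-≈ᴸ N d) d⋆a
    where
    N = suc T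
    ê : Series
    ê i = ∑≤ i (e i)

    -- Up to index `T` the truncation of `d` is not visible and the coefficients are those of the
    -- numerator; beyond `T` the recurrence makes them vanish.
    d⋆a : truncate N d ⋆ a ≋ truncate T ê
    d⋆a n with ℕ.≤-<-connex n T
    ... | inj₁ n≤T = begin
      (truncate N d ⋆ a) n ≈⟨ truncate-⋆-low N d a (ℕ.m≤n⇒m≤1+n n≤T) ⟩
      (d ⋆ a) n            ≈⟨ ∑-cong n (λ j _ → da≈e n j) ⟩
      ê n                  ≈⟨ truncate-low T ê n≤T ⟨
      truncate T ê n       ∎
    ... | inj₂ T<n with ℕ.m≤n⇒∃[o]m+o≡n T<n
    ... | k , ≡.refl = begin
      (truncate N d ⋆ a) (N + k)              ≈⟨ truncate-⋆-high N d a k ⟩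
      (∑[ j ≤ N ] (d j · a (N + k ∸ j)))      ≈⟨ d⊥a k ⟩
      0#                                      ≈⟨ truncate-high T ê k ⟨
      truncate T ê (N + k)                    ∎

-- triangle j is the binomial coefficient j(j-1)/2.
triangle : ℕ → ℕ
triangle zero    = 0
triangle (suc j) = j + triangle j

-- Throughout, negation is multiplication by ν, so that the identities to be checked hold
-- in commutative semirings, up to multiples of 1 + ν.
module MinusOne {c ℓ} (R : CommutativeRing c ℓ) where
  open CommutativeRing R renaming (_+_ to _⊹_; _*_ to _·_)
  open Algebra.Properties.CommutativeSemiring.Exp commutativeSemiring
  open Relation.Binary.Reasoning.Setoid setoid

  ν : Carrier
  ν = - 1#

  x+νx≈0 : ∀ x → x ⊹ ν · x ≈ 0#
  x+νx≈0 x = begin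
    x ⊹ ν · x      ≈⟨ +-congʳ (*-identityˡ x) ⟨
    1# · x ⊹ ν · x ≈⟨ distribʳ x 1# ν ⟨
    (1# ⊹ ν) · x   ≈⟨ *-congʳ (-‿inverseʳ 1#) ⟩
    0# · x         ≈⟨ zeroˡ x ⟩
    0#             ∎

  x+y+νy≈x : ∀ x y → x ⊹ (y ⊹ ν · y) ≈ x
  x+y+νy≈x x y = trans (+-congˡ (x+νx≈0 y)) (+-identityʳ x)

  ν·ν≈1 : ν · ν ≈ 1#
  ν·ν≈1 = begin
    ν · ν               ≈⟨ +-identityˡ _ ⟨
    0# ⊹ ν · ν          ≈⟨ +-congʳ (-‿inverseʳ 1#) ⟨
    (1# ⊹ ν) ⊹ ν · ν    ≈⟨ +-assoc _ _ _ ⟩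
    1# ⊹ (ν ⊹ ν · ν)    ≈⟨ x+y+νy≈x 1# ν ⟩
    1#                  ∎

  1^n≈1 : ∀ n → 1# ^ n ≈ 1#
  1^n≈1 zero    = refl
  1^n≈1 (suc n) = trans (*-identityˡ _) (1^n≈1 n)

  ν^2n≈1 : ∀ n → ν ^ (2 * n) ≈ 1#
  ν^2n≈1 n = begin
    ν ^ (2 * n)  ≈⟨ ^-assocʳ ν 2 n ⟨
    (ν ^ 2) ^ n  ≈⟨ ^-congˡ n (trans (*-congˡ (*-identityʳ ν)) ν·ν≈1) ⟩
    1# ^ n       ≈⟨ 1^n≈1 n ⟩
    1#           ∎

-- Linear recurrences, and those with Gaussian binomial coefficients

module Annihilation {c ℓ} (R : CommutativeRing c ℓ) where
  open CommutativeRing R renaming (_+_ to _⊹_; _*_ to _·_)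
  open FiniteSums R
  open Algebra.Properties.CommutativeSemigroup *-commutativeSemigroup using (x∙yz≈y∙xz)
  open Relation.Binary.Reasoning.Setoid setoid

  -- A linear recurrence of order `N` for `g`, indexed so that the subtraction is exact for every j
  -- ≤ N.
  Annihilates : ℕ → (ℕ → Carrier) → (ℕ → Carrier) → Set ℓ
  Annihilates N e g = ∀ k → (∑[ j ≤ N ] (e j · g (N + k ∸ j))) ≈ 0#

  annihilates-cong : ∀ N e {f g} → (∀ n → f n ≈ g n) →
                     Annihilates N e f → Annihilates N e g
  annihilates-cong N e f≈g e⊥f k =
    trans (∑-cong N (λ j _ → *-congˡ {e j} (sym (f≈g (N + k ∸ j))))) (e⊥f k)

  annihilates-+ : ∀ N e {f g} → Annihilates N e f → Annihilates N e g →
                  Annihilates N e (λ n → f n ⊹ g n)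
  annihilates-+ N e {f} {g} e⊥f e⊥g k = begin
    (∑[ j ≤ N ] (e j · (f (N + k ∸ j) ⊹ g (N + k ∸ j))))
      ≈⟨ ∑-cong N (λ j _ → distribˡ (e j) (f (N + k ∸ j)) (g (N + k ∸ j))) ⟩
    (∑[ j ≤ N ] (e j · f (N + k ∸ j) ⊹ e j · g (N + k ∸ j)))
      ≈⟨ ∑-+ N (λ j → e j · f (N + k ∸ j)) (λ j → e j · g (N + k ∸ j)) ⟩
    (∑[ j ≤ N ] (e j · f (N + k ∸ j))) ⊹ (∑[ j ≤ N ] (e j · g (N + k ∸ j)))
      ≈⟨ +-cong (e⊥f k) (e⊥g k) ⟩
    0# ⊹ 0#
      ≈⟨ +-identityˡ 0# ⟩
    0# ∎

  annihilates-scale : ∀ N e {g} r → Annihilates N e g → Annihilates N e (λ n → r · g n)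
  annihilates-scale N e {g} r e⊥g k = begin
    (∑[ j ≤ N ] (e j · (r · g (N + k ∸ j))))
      ≈⟨ ∑-cong N (λ j _ → x∙yz≈y∙xz (e j) r (g (N + k ∸ j))) ⟩
    (∑[ j ≤ N ] (r · (e j · g (N + k ∸ j))))
      ≈⟨ *-∑ N r (λ j → e j · g (N + k ∸ j)) ⟨
    r · (∑[ j ≤ N ] (e j · g (N + k ∸ j)))
      ≈⟨ *-congˡ (e⊥g k) ⟩
    r · 0#
      ≈⟨ zeroʳ r ⟩
    0# ∎

-- The rule which determines the Gaussian binomials in homogeneous form.
record PascalRule {c ℓ} (R : CommutativeRing c ℓ) (p q : CommutativeRing.Carrier R)
                  (B : ℕ → ℕ → CommutativeRing.Carrier R) : Set ℓ where
  open CommutativeRing R renaming (_+_ to _⊹_; _*_ to _·_)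
  open Algebra.Properties.CommutativeSemiring.Exp commutativeSemiring using (_^_)
  field
    B-0      : ∀ n → B (suc n) 0 ≈ B n 0
    B-pascal : ∀ n k → k ≤ n → B (suc n) (suc k) ≈ p ^ suc k · B n (suc k) ⊹ q ^ (n ∸ k) · B n k
    B-beyond : ∀ n → B n (suc n) ≈ 0#

module GaussianBinomials
  {c ℓ} (R : CommutativeRing c ℓ) (p q : CommutativeRing.Carrier R)
  (B : ℕ → ℕ → CommutativeRing.Carrier R) (pascalRule : PascalRule R p q B) where
  open CommutativeRing R renaming (_+_ to _⊹_; _*_ to _·_)
  open PascalRule pascalRule
  open Algebra.Properties.CommutativeSemiring.Exp commutativeSemiring
  open Algebra.Solver.Ring.NaturalCoefficients.Default commutativeSemiring
    using (solve; _:+_; _:*_; _:=_)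
  open FiniteSums R
  open MinusOne R
  open Annihilation R
  open Relation.Binary.Reasoning.Setoid setoid

  characteristic : ℕ → ℕ → Carrier
  characteristic N j = ν ^ j · ((p · q) ^ triangle j · B N j)

  -- This form is `B 0 0` times the product of the factors a - pⁱqʲb over i + j + 1 = N. The second
  -- variable is needed because splitting off a factor replaces b by pb.
  homogeneous : ℕ → Carrier → Carrier → Carrier
  homogeneous N a b = ∑[ j ≤ N ] (characteristic N j · (a ^ (N ∸ j) · b ^ j))

  homogeneous-cong : ∀ N {a a′ b b′} → a ≈ a′ → b ≈ b′ →
                     homogeneous N a b ≈ homogeneous N a′ b′
  homogeneous-cong N a≈a′ b≈b′ =
    ∑-cong N (λ j _ → *-congˡ {characteristic N j} (*-cong (^-congˡ (N ∸ j) a≈a′) (^-congˡ j b≈b′)))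

  -- The q-binomial theorem, one factor at a time.
  homogeneous-suc : ∀ N a b →
    homogeneous (suc N) a b ≈ (a ⊹ ν · (q ^ N · b)) · homogeneous N a (p · b)
  homogeneous-suc N a b = begin
    homogeneous (suc N) a b
      ≈⟨ +-cong first (∑-cong N step) ⟩
    X 0 ⊹ (∑[ k ≤ N ] (X (suc k) ⊹ Y k))
      ≈⟨ +-congˡ (∑-+ N (λ k → X (suc k)) Y) ⟩
    X 0 ⊹ ((∑[ k ≤ N ] X (suc k)) ⊹ ∑≤ N Y)
      ≈⟨ +-assoc _ _ _ ⟨
    ∑≤ (suc N) X ⊹ ∑≤ N Y
      ≈⟨ +-congʳ (trans (∑-last N X) (trans (+-congˡ last) (+-identityʳ _))) ⟩
    ∑≤ N X ⊹ ∑≤ N Y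
      ≈⟨ +-cong (trans (∑-cong N X≈aZ) (sym (*-∑ N a Z))) (sym (*-∑ N (ν · (q ^ N · b)) Z)) ⟩
    a · ∑≤ N Z ⊹ ν · (q ^ N · b) · ∑≤ N Z
      ≈⟨ distribʳ _ _ _ ⟨
    (a ⊹ ν · (q ^ N · b)) · homogeneous N a (p · b) ∎
    where
    -- `X` and `Y` collect the two summands of the Pascal rule; `Z` is the general term of the
    -- smaller form, of which both are multiples.
    X Y Z : ℕ → Carrier
    X j = characteristic N j · (p ^ j · (a ^ (suc N ∸ j) · b ^ j))
    Z j = characteristic N j · (a ^ (N ∸ j) · (p · b) ^ j)
    Y j = ν · (q ^ N · b) · Z j

    first : characteristic (suc N) 0 · (a ^ suc N · 1#) ≈ X 0
    first = *-cong (*-congˡ (*-congˡ (B-0 N))) (sym (*-identityˡ _))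

    last : X (suc N) ≈ 0#
    last = trans (*-congʳ (trans (*-congˡ (trans (*-congˡ (B-beyond N)) (zeroʳ _))) (zeroʳ _)))
                 (zeroˡ _)

    X≈aZ : ∀ j → j ≤ N → X j ≈ a · Z j
    X≈aZ j j≤N = begin
      characteristic N j · (p ^ j · (a ^ (suc N ∸ j) · b ^ j))
        ≈⟨ *-congˡ (*-congˡ (*-congʳ (^-congʳ a (ℕ.+-∸-assoc 1 j≤N)))) ⟩
      characteristic N j · (p ^ j · (a · a ^ (N ∸ j) · b ^ j))
        ≈⟨ solve 5 (λ C P A a^ b^ → C :* (P :* (A :* a^ :* b^)) := A :* (C :* (a^ :* (P :* b^))))
             refl _ _ _ _ _ ⟩
      a · (characteristic N j · (a ^ (N ∸ j) · (p ^ j · b ^ j)))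
        ≈⟨ *-congˡ (*-congˡ (*-congˡ (^-distrib-* p b j))) ⟨
      a · Z j ∎

    -- This explains the weight (pq)^`triangle`: from k to k + 1 it gains (pq)^k. Together with
    -- q^(N-k) from the Pascal rule this is p^k q^N, where q^N no longer depends on k and p^k is
    -- absorbed by (pb)^k.
    powers : ∀ k → k ≤ N → (p · q) ^ (k + triangle k) · q ^ (N ∸ k)
                         ≈ p ^ k · (q ^ N · (p · q) ^ triangle k)
    powers k k≤N = begin
      (p · q) ^ (k + triangle k) · q ^ (N ∸ k)
        ≈⟨ *-congʳ (trans (^-homo-* (p · q) k (triangle k)) (*-congʳ (^-distrib-* p q k))) ⟩
      p ^ k · q ^ k · (p · q) ^ triangle k · q ^ (N ∸ k)
        ≈⟨ solve 4 (λ P Q T Q′ → P :* Q :* T :* Q′ := P :* (Q :* Q′ :* T)) refl _ _ _ _ ⟩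
      p ^ k · (q ^ k · q ^ (N ∸ k) · (p · q) ^ triangle k)
        ≈⟨ *-congˡ (*-congʳ (trans (sym (^-homo-* q k (N ∸ k))) (^-congʳ q (ℕ.m+[n∸m]≡n k≤N)))) ⟩
      p ^ k · (q ^ N · (p · q) ^ triangle k) ∎

    step : ∀ k → k ≤ N → characteristic (suc N) (suc k) · (a ^ (N ∸ k) · b ^ suc k)
                         ≈ X (suc k) ⊹ Y k
    step k k≤N = begin
      ν ^ suc k · (T · B (suc N) (suc k)) · ab
        ≈⟨ *-congʳ (*-congˡ (*-congˡ (B-pascal N k k≤N))) ⟩
      ν ^ suc k · (T · (p ^ suc k · B N (suc k) ⊹ q ^ (N ∸ k) · B N k)) · ab
        ≈⟨ solve 7 (λ S T P B₁ Q B₂ C → S :* (T :* (P :* B₁ :+ Q :* B₂)) :* C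
                      := S :* (T :* B₁) :* (P :* C) :+ T :* Q :* (S :* B₂ :* C))
             refl _ _ _ _ _ _ _ ⟩
      X (suc k) ⊹ T · q ^ (N ∸ k) · (ν ^ suc k · B N k · ab)
        ≈⟨ +-congˡ (*-congʳ (powers k k≤N)) ⟩
      X (suc k) ⊹ p ^ k · (q ^ N · (p · q) ^ triangle k) · (ν ^ suc k · B N k · ab)
        ≈⟨ +-congˡ (solve 9 (λ P Q T n N B A b b^ →
               P :* (Q :* T) :* (n :* N :* B :* (A :* (b :* b^)))
                 := n :* (Q :* b) :* (N :* (T :* B) :* (A :* (P :* b^))))
             refl _ _ _ _ _ _ _ _ _) ⟩
      X (suc k) ⊹ ν · (q ^ N · b) · (characteristic N k · (a ^ (N ∸ k) · (p ^ k · b ^ k)))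
        ≈⟨ +-congˡ (*-congˡ (*-congˡ (*-congˡ (^-distrib-* p b k)))) ⟨
      X (suc k) ⊹ Y k ∎
      where
      T  = (p · q) ^ (k + triangle k)
      ab = a ^ (N ∸ k) · b ^ suc k

  -- For i = 0 the factor split off by `homogeneous-suc` vanishes. Otherwise pⁱqʲb = pⁱ⁻¹qʲ(pb) is a
  -- root of the other factor, by induction with pb in place of b.
  homogeneous-root : ∀ i j b → homogeneous (suc (i + j)) (p ^ i · (q ^ j · b)) b ≈ 0#
  homogeneous-root zero j b = begin
    homogeneous (suc j) a b                                      ≈⟨ homogeneous-suc j a b ⟩
    (a ⊹ ν · (q ^ j · b)) · homogeneous j a (p · b)              ≈⟨ *-congʳ (+-congʳ (*-identityˡ _)) ⟩
    (q ^ j · b ⊹ ν · (q ^ j · b)) · homogeneous j a (p · b)      ≈⟨ *-congʳ (x+νx≈0 _) ⟩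
    0# · homogeneous j a (p · b)                                 ≈⟨ zeroˡ _ ⟩
    0#                                                           ∎
    where a = 1# · (q ^ j · b)
  homogeneous-root (suc i) j b = begin
    homogeneous (suc (suc (i + j))) a b
      ≈⟨ homogeneous-suc (suc (i + j)) a b ⟩
    (a ⊹ ν · (q ^ suc (i + j) · b)) · homogeneous (suc (i + j)) a (p · b)
      ≈⟨ *-congˡ (homogeneous-cong (suc (i + j))
           (solve 4 (λ p P Q b → p :* P :* (Q :* b) := P :* (Q :* (p :* b))) refl _ _ _ _) refl) ⟩
    (a ⊹ ν · (q ^ suc (i + j) · b)) ·
      homogeneous (suc (i + j)) (p ^ i · (q ^ j · (p · b))) (p · b)
      ≈⟨ *-congˡ (homogeneous-root i j (p · b)) ⟩
    (a ⊹ ν · (q ^ suc (i + j) · b)) · 0#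
      ≈⟨ zeroʳ _ ⟩
    0# ∎
    where a = p ^ suc i · (q ^ j · b)

  -- On a geometric sequence the recurrence at k is r^k times the value of the form at (r, 1), and r
  -- = pⁱqʲ is a root.
  geometric-annihilated : ∀ {T} i j → i + j ≡ T → ∀ r → p ^ i · q ^ j ≈ r →
                          Annihilates (suc T) (characteristic (suc T)) (r ^_)
  geometric-annihilated {T} i j ≡.refl r p^iq^j≈r k = begin
    (∑[ l ≤ N ] (characteristic N l · r ^ (N + k ∸ l)))
      ≈⟨ ∑-cong N (λ l l≤N → trans (*-congˡ {characteristic N l} (split l l≤N))
           (solve 4 (λ C R I K → C :* (R :* I :* K) := K :* (C :* (R :* I)))
             refl (characteristic N l) _ _ _)) ⟩
    (∑[ l ≤ N ] (r ^ k · (characteristic N l · (r ^ (N ∸ l) · 1# ^ l))))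
      ≈⟨ *-∑ N (r ^ k) (λ l → characteristic N l · (r ^ (N ∸ l) · 1# ^ l)) ⟨
    r ^ k · homogeneous N r 1#
      ≈⟨ *-congˡ (homogeneous-cong N (trans (sym p^iq^j≈r) (*-congˡ (sym (*-identityʳ _)))) refl) ⟩
    r ^ k · homogeneous N (p ^ i · (q ^ j · 1#)) 1#
      ≈⟨ *-congˡ (homogeneous-root i j 1#) ⟩
    r ^ k · 0#
      ≈⟨ zeroʳ _ ⟩
    0# ∎
    where
    N = suc T
    split : ∀ l → l ≤ N → r ^ (N + k ∸ l) ≈ r ^ (N ∸ l) · 1# ^ l · r ^ k
    split l l≤N = begin
      r ^ (N + k ∸ l)                ≈⟨ ^-congʳ r (ℕ.+-∸-comm k l≤N) ⟩
      r ^ (N ∸ l + k)                ≈⟨ ^-homo-* r (N ∸ l) k ⟩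
      r ^ (N ∸ l) · r ^ k            ≈⟨ *-congʳ (trans (*-congˡ (1^n≈1 l)) (*-identityʳ _)) ⟨
      r ^ (N ∸ l) · 1# ^ l · r ^ k   ∎

  -- Multiplying out gives four geometric sequences, with ratios pⁱqʲ for (i, j) = (t₁+t₂, 0), (t₁,
  -- t₂), (t₂, t₁), (0, t₁+t₂). Each is annihilated separately, so coinciding ratios do no harm.
  product-annihilated : ∀ t₁ t₂ {g₁ g₂ : ℕ → Carrier} {c₁ d₁ c₂ d₂} →
    (∀ n → g₁ n ≈ c₁ · (p ^ t₁) ^ n ⊹ d₁ · (q ^ t₁) ^ n) →
    (∀ n → g₂ n ≈ c₂ · (p ^ t₂) ^ n ⊹ d₂ · (q ^ t₂) ^ n) →
    Annihilates (suc (t₁ + t₂)) (characteristic (suc (t₁ + t₂))) (λ n → g₁ n · g₂ n)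
  product-annihilated t₁ t₂ {g₁} {g₂} {c₁} {d₁} {c₂} {d₂} g₁≈ g₂≈ =
    annihilates-cong N e (λ n → sym (expand n))
      (annihilates-+ N e {λ n → term₁ n ⊹ term₂ n} {λ n → term₃ n ⊹ term₄ n}
        (annihilates-+ N e {term₁} {term₂} (root-term (c₁ · c₂) (t₁ + t₂) 0 (ℕ.+-identityʳ _) pp)
                                           (root-term (c₁ · d₂) t₁ t₂ ≡.refl refl))
        (annihilates-+ N e {term₃} {term₄} (root-term (d₁ · c₂) t₂ t₁ (ℕ.+-comm t₂ t₁) (*-comm _ _))
                                           (root-term (d₁ · d₂) 0 (t₁ + t₂) ≡.refl qq)))
    where
    N = suc (t₁ + t₂)
    e = characteristic N

    pp : p ^ (t₁ + t₂) · q ^ 0 ≈ p ^ t₁ · p ^ t₂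
    pp = trans (*-identityʳ _) (^-homo-* p t₁ t₂)

    qq : p ^ 0 · q ^ (t₁ + t₂) ≈ q ^ t₁ · q ^ t₂
    qq = trans (*-identityˡ _) (^-homo-* q t₁ t₂)

    term₁ term₂ term₃ term₄ : ℕ → Carrier
    term₁ n = c₁ · c₂ · ((p ^ t₁) ^ n · (p ^ t₂) ^ n)
    term₂ n = c₁ · d₂ · ((p ^ t₁) ^ n · (q ^ t₂) ^ n)
    term₃ n = d₁ · c₂ · ((q ^ t₁) ^ n · (p ^ t₂) ^ n)
    term₄ n = d₁ · d₂ · ((q ^ t₁) ^ n · (q ^ t₂) ^ n)

    root-term : ∀ r i j → i + j ≡ t₁ + t₂ → ∀ {u v} → p ^ i · q ^ j ≈ u · v →
           Annihilates N e (λ n → r · (u ^ n · v ^ n))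
    root-term r i j i+j≡ {u} {v} root =
      annihilates-cong N e (λ n → *-congˡ {r} (^-distrib-* u v n))
        (annihilates-scale N e {λ n → (u · v) ^ n} r (geometric-annihilated i j i+j≡ (u · v) root))

    expand : ∀ n → g₁ n · g₂ n ≈ (term₁ n ⊹ term₂ n) ⊹ (term₃ n ⊹ term₄ n)
    expand n = trans (*-cong (g₁≈ n) (g₂≈ n))
      (solve 8 (λ c₁ d₁ c₂ d₂ P₁ Q₁ P₂ Q₂ →
          (c₁ :* P₁ :+ d₁ :* Q₁) :* (c₂ :* P₂ :+ d₂ :* Q₂) :=
            (c₁ :* c₂ :* (P₁ :* P₂) :+ c₁ :* d₂ :* (P₁ :* Q₂)) :+
            (d₁ :* c₂ :* (Q₁ :* P₂) :+ d₁ :* d₂ :* (Q₁ :* Q₂)))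
        refl _ _ _ _ _ _ _ _)

-- Binet's formula and the addition formula

module SecondOrderRecurrence {c ℓ} (R : CommutativeRing c ℓ) where
  open CommutativeRing R renaming (_+_ to _⊹_; _*_ to _·_)
  open Algebra.Properties.CommutativeSemiring.Exp commutativeSemiring
  open Algebra.Solver.Ring.NaturalCoefficients.Default commutativeSemiring
    using (solve; _:+_; _:*_; _:=_)
  open MinusOne R
  open Relation.Binary.Reasoning.Setoid setoid

  record Roots (x y α β : Carrier) : Set ℓ where
    field
      sum-≈     : α ⊹ β ≈ x
      product-≈ : ν · (α · β) ≈ y

  swap : ∀ {x y α β} → Roots x y α β → Roots x y β α
  swap roots = record
    { sum-≈     = trans (+-comm _ _) (Roots.sum-≈ roots)
    ; product-≈ = trans (*-congˡ (*-comm _ _)) (Roots.product-≈ roots) }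

  Solves : Carrier → Carrier → (ℕ → Carrier) → Set ℓ
  Solves x y g = ∀ n → g (suc (suc n)) ≈ x · g (suc n) ⊹ y · g n

  module _ {x y α β} (roots : Roots x y α β) {g : ℕ → Carrier} (g-solves : Solves x y g) where
    open Roots roots

    -- The factorisation t² - xt - y = (t - α)(t - β): applying the factor of β to `g` leaves a
    -- first-order recurrence with ratio α.
    reduce-order : ∀ n → g (suc n) ⊹ ν · (β · g n) ≈ (g 1 ⊹ ν · (β · g 0)) · α ^ n
    reduce-order zero    = sym (*-identityʳ _)
    reduce-order (suc n) = begin
      g (suc (suc n)) ⊹ ν · (β · g (suc n))
        ≈⟨ +-congʳ (trans (g-solves n) (+-cong (*-congʳ (sym sum-≈)) (*-congʳ (sym product-≈)))) ⟩
      (α ⊹ β) · g (suc n) ⊹ ν · (α · β) · g n ⊹ ν · (β · g (suc n))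
        ≈⟨ solve 5 (λ n α β g₁ g₀ →
             (α :+ β) :* g₁ :+ n :* (α :* β) :* g₀ :+ n :* (β :* g₁) :=
             α :* (g₁ :+ n :* (β :* g₀)) :+ (β :* g₁ :+ n :* (β :* g₁))) refl _ _ _ _ _ ⟩
      α · (g (suc n) ⊹ ν · (β · g n)) ⊹ (β · g (suc n) ⊹ ν · (β · g (suc n)))
        ≈⟨ x+y+νy≈x _ _ ⟩
      α · (g (suc n) ⊹ ν · (β · g n))
        ≈⟨ *-congˡ (reduce-order n) ⟩
      α · ((g 1 ⊹ ν · (β · g 0)) · α ^ n)
        ≈⟨ solve 3 (λ a c p → a :* (c :* p) := c :* (a :* p)) refl _ _ _ ⟩
      (g 1 ⊹ ν · (β · g 0)) · (α · α ^ n) ∎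

  module _ {x y α β} (roots : Roots x y α β) where
    open Roots roots

    -- α - β
    δ : Carrier
    δ = ν · (β ⊹ ν · α)

    binet : ∀ {g} → Solves x y g → ∀ n →
            δ · g n ≈ (g 1 ⊹ ν · (β · g 0)) · α ^ n ⊹ ν · (g 1 ⊹ ν · (α · g 0)) · β ^ n
    binet {g} g-solves n = begin
      δ · g n
        -- Adding g(n+1) - g(n+1) exhibits δ g(n) as the difference of the two reduced sequences.
        -- With `δ` written as `ν · (β ⊹ ν · α)` the regrouping does not need ν² = 1.
        ≈⟨ x+y+νy≈x _ _ ⟨
      δ · g n ⊹ (g (suc n) ⊹ ν · g (suc n))
        ≈⟨ solve 5 (λ n α β g₁ g₀ →
             n :* (β :+ n :* α) :* g₀ :+ (g₁ :+ n :* g₁) :=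
             (g₁ :+ n :* (β :* g₀)) :+ n :* (g₁ :+ n :* (α :* g₀))) refl _ _ _ _ _ ⟩
      (g (suc n) ⊹ ν · (β · g n)) ⊹ ν · (g (suc n) ⊹ ν · (α · g n))
        ≈⟨ +-cong (reduce-order roots g-solves n)
                  (trans (*-congˡ (reduce-order (swap roots) g-solves n)) (sym (*-assoc _ _ _))) ⟩
      (g 1 ⊹ ν · (β · g 0)) · α ^ n ⊹ ν · (g 1 ⊹ ν · (α · g 0)) · β ^ n ∎

    δ·δ≈x²+4y : δ · δ ≈ x · x ⊹ (y ⊹ y ⊹ (y ⊹ y))
    δ·δ≈x²+4y = begin
      δ · δ
        ≈⟨ solve 3 (λ n α β → n :* (β :+ n :* α) :* (n :* (β :+ n :* α)) :=
             n :* n :* (β :* β :+ n :* (α :* β) :+ n :* (α :* β) :+ n :* n :* (α :* α))) refl ν α β ⟩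
      ν · ν · (β · β ⊹ ν · (α · β) ⊹ ν · (α · β) ⊹ ν · ν · (α · α))
        ≈⟨ trans (*-congʳ ν·ν≈1) (*-identityˡ _) ⟩
      β · β ⊹ ν · (α · β) ⊹ ν · (α · β) ⊹ ν · ν · (α · α)
        ≈⟨ +-congˡ (trans (*-congʳ ν·ν≈1) (*-identityˡ _)) ⟩
      β · β ⊹ ν · (α · β) ⊹ ν · (α · β) ⊹ α · α
        -- Completing the square: adding 2αβ - 2αβ turns α² - 2αβ + β² into (α + β)² - 4αβ, and -αβ
        -- is y.
        ≈⟨ x+y+νy≈x _ (α · β ⊹ α · β) ⟨
      β · β ⊹ ν · (α · β) ⊹ ν · (α · β) ⊹ α · α ⊹ (α · β ⊹ α · β ⊹ ν · (α · β ⊹ α · β))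
        ≈⟨ solve 3 (λ n α β → β :* β :+ n :* (α :* β) :+ n :* (α :* β) :+ α :* α
                :+ (α :* β :+ α :* β :+ n :* (α :* β :+ α :* β)) :=
             (α :+ β) :* (α :+ β) :+ (n :* (α :* β) :+ n :* (α :* β) :+ (n :* (α :* β) :+ n :* (α :* β))))
             refl ν α β ⟩
      (α ⊹ β) · (α ⊹ β) ⊹ (ν · (α · β) ⊹ ν · (α · β) ⊹ (ν · (α · β) ⊹ ν · (α · β)))
        ≈⟨ +-cong (*-cong sum-≈ sum-≈)
             (+-cong (+-cong product-≈ product-≈) (+-cong product-≈ product-≈)) ⟩
      x · x ⊹ (y ⊹ y ⊹ (y ⊹ y)) ∎

    module _ {f : ℕ → Carrier} (f-solves : Solves x y f) (f₀≈0 : f 0 ≈ 0#) (f₁≈1 : f 1 ≈ 1#) where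

      f-suc : ∀ n → f (suc n) ≈ α · f n ⊹ β ^ n
      f-suc n = begin
        f (suc n)
          ≈⟨ x+y+νy≈x _ _ ⟨
        f (suc n) ⊹ (α · f n ⊹ ν · (α · f n))
          ≈⟨ solve 3 (λ a b c → a :+ (b :+ c) := b :+ (a :+ c)) refl _ _ _ ⟩
        α · f n ⊹ (f (suc n) ⊹ ν · (α · f n))
          ≈⟨ +-congˡ (reduce-order (swap roots) f-solves n) ⟩
        α · f n ⊹ (f 1 ⊹ ν · (α · f 0)) · β ^ n
          ≈⟨ +-congˡ (*-congʳ (+-cong f₁≈1 (*-congˡ (trans (*-congˡ f₀≈0) (zeroʳ α))))) ⟩
        α · f n ⊹ (1# ⊹ ν · 0#) · β ^ n
          ≈⟨ +-congˡ (trans (*-congʳ (trans (+-congˡ (zeroʳ ν)) (+-identityʳ 1#))) (*-identityˡ _)) ⟩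
        α · f n ⊹ β ^ n ∎

      -- Induction with `f-suc` avoids the division by α - β that a derivation from Binet's formula
      -- would need. The asymmetry, α in one term and β in the other, is that of the Pascal rule.
      f-+ : ∀ m n → f (m + n) ≈ α ^ m · f n ⊹ β ^ n · f m
      f-+ zero    n = sym (trans (+-cong (*-identityˡ _) (trans (*-congˡ f₀≈0) (zeroʳ _)))
                                 (+-identityʳ _))
      f-+ (suc m) n = begin
        f (suc (m + n))
          ≈⟨ f-suc (m + n) ⟩
        α · f (m + n) ⊹ β ^ (m + n)
          ≈⟨ +-cong (*-congˡ (f-+ m n)) (^-homo-* β m n) ⟩
        α · (α ^ m · f n ⊹ β ^ n · f m) ⊹ β ^ m · β ^ n
          ≈⟨ solve 6 (λ α A B C fn fm → α :* (A :* fn :+ B :* fm) :+ C :* B :=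
               α :* A :* fn :+ B :* (α :* fm :+ C)) refl _ _ _ _ _ _ ⟩
        α · α ^ m · f n ⊹ β ^ n · (α · f m ⊹ β ^ m)
          ≈⟨ +-congˡ (*-congˡ (f-suc m)) ⟨
        α ^ suc m · f n ⊹ β ^ n · f (suc m) ∎

-- Adjoining the roots of t² = xt + y

-- A ring is enough: injectivity of `ε` brings equations back to K, and only elements coming from K
-- are ever cancelled.
record SplitExtension {c ℓ} (K : CommutativeRing c ℓ) (x y : CommutativeRing.Carrier K) :
       Set (lsuc (c ⊔ ℓ)) where
  field
    ring           : CommutativeRing c ℓ
    ε              : CommutativeRing.Carrier K → CommutativeRing.Carrier ring
    isMonomorphism : IsRingMonomorphism (CommutativeRing.rawRing K) (CommutativeRing.rawRing ring) ε
    α β            : CommutativeRing.Carrier ring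
    roots          : SecondOrderRecurrence.Roots ring (ε x) (ε y) α β

module QuadraticExtension {c ℓ} (K : CommutativeRing c ℓ) (x y : CommutativeRing.Carrier K) where
  open CommutativeRing K renaming (_+_ to _⊹_; _*_ to _·_)
  open Algebra.Properties.Ring (CommutativeRing.ring K) using (-0#≈0#; -1*x≈-x; -‿involutive)
  open Algebra.Solver.Ring.NaturalCoefficients.Default commutativeSemiring
    using (solve; _:+_; _:*_; _:=_)
  module K² = CommutativeRing (Algebra.Construct.DirectProduct.commutativeRing K K)

  -- (a , b) stands for a + bα, where α² = xα + y.
  infixl 7 _⊛_
  _⊛_ : Carrier × Carrier → Carrier × Carrier → Carrier × Carrier
  (a , b) ⊛ (a′ , b′) = a · a′ ⊹ y · (b · b′) , a · b′ ⊹ b · a′ ⊹ x · (b · b′)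

  -- The quotient K[t]/(t² - xt - y), additively K × K. Irreducibility of the polynomial does not
  -- enter.
  K[α] : CommutativeRing c ℓ
  K[α] = record
    { Carrier = Carrier × Carrier ; _≈_ = K²._≈_
    ; _+_ = K²._+_ ; _*_ = _⊛_ ; -_ = K².-_ ; 0# = K².0# ; 1# = 1# , 0#
    ; isCommutativeRing = record
      { isRing = record
        { +-isAbelianGroup = K².+-isAbelianGroup
        ; *-cong = λ { (p , q) (p′ , q′) →
            +-cong (*-cong p p′) (*-congˡ (*-cong q q′)) ,
            +-cong (+-cong (*-cong p q′) (*-cong q p′)) (*-congˡ (*-cong q q′)) }
        ; *-assoc = λ { (a , b) (c , d) (e , f) →
            solve 8 (λ x y a b c d e f →
              (a :* c :+ y :* (b :* d)) :* e :+ y :* ((a :* d :+ b :* c :+ x :* (b :* d)) :* f) :=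
              a :* (c :* e :+ y :* (d :* f)) :+ y :* (b :* (c :* f :+ d :* e :+ x :* (d :* f))))
              refl x y a b c d e f ,
            solve 8 (λ x y a b c d e f →
              (a :* c :+ y :* (b :* d)) :* f :+ (a :* d :+ b :* c :+ x :* (b :* d)) :* e
                :+ x :* ((a :* d :+ b :* c :+ x :* (b :* d)) :* f) :=
              a :* (c :* f :+ d :* e :+ x :* (d :* f)) :+ b :* (c :* e :+ y :* (d :* f))
                :+ x :* (b :* (c :* f :+ d :* e :+ x :* (d :* f))))
              refl x y a b c d e f }
        ; *-identity = identityˡ , (λ u → K².trans (comm u _) (identityˡ u))
        ; distrib = distˡ , (λ u v w →
            K².trans (comm (v K².+ w) u) (K².trans (distˡ u v w) (K².+-cong (comm u v) (comm u w))))
        }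
      ; *-comm = comm
      }
    }
    where
    comm : ∀ u v → u ⊛ v K².≈ v ⊛ u
    comm (a , b) (c , d) =
      +-cong (*-comm a c) (*-congˡ (*-comm b d)) ,
      +-cong (trans (+-comm _ _) (+-cong (*-comm b c) (*-comm a d))) (*-congˡ (*-comm b d))

    distˡ : ∀ u v w → u ⊛ (v K².+ w) K².≈ (u ⊛ v) K².+ (u ⊛ w)
    distˡ (a , b) (c , d) (e , f) =
      solve 7 (λ y a b c d e f → a :* (c :+ e) :+ y :* (b :* (d :+ f)) :=
        a :* c :+ y :* (b :* d) :+ (a :* e :+ y :* (b :* f))) refl y a b c d e f ,
      solve 7 (λ x a b c d e f → a :* (d :+ f) :+ b :* (c :+ e) :+ x :* (b :* (d :+ f)) :=
        a :* d :+ b :* c :+ x :* (b :* d) :+ (a :* f :+ b :* e :+ x :* (b :* f))) refl x a b c d e f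

    r·[0·s]≈0 : ∀ r s → r · (0# · s) ≈ 0#
    r·[0·s]≈0 r s = trans (*-congˡ (zeroˡ s)) (zeroʳ r)

    identityˡ : ∀ u → (1# , 0#) ⊛ u K².≈ u
    identityˡ (a , b) =
      trans (+-cong (*-identityˡ a) (r·[0·s]≈0 y b)) (+-identityʳ a) ,
      trans (+-cong (+-cong (*-identityˡ b) (zeroˡ a)) (r·[0·s]≈0 x b))
        (trans (+-identityʳ _) (+-identityʳ b))

  embed : Carrier → Carrier × Carrier
  embed a = a , 0#

  splitExtension : SplitExtension K x y
  splitExtension = record
    { ring = K[α]
    ; ε = embed
    ; isMonomorphism = record
      { isRingHomomorphism = record
        { isSemiringHomomorphism = record
          { isNearSemiringHomomorphism = record
            { +-isMonoidHomomorphism = record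
              { isMagmaHomomorphism = record
                { isRelHomomorphism = record { cong = λ a≈b → a≈b , refl }
                ; homo = λ a b → refl , sym (+-identityˡ 0#) }
              ; ε-homo = K².refl }
            ; *-homo = λ a b →
                sym (trans (+-congˡ (trans (*-congˡ (zeroˡ 0#)) (zeroʳ y))) (+-identityʳ _)) ,
                sym (trans (+-cong (+-cong (zeroʳ a) (zeroˡ b)) (trans (*-congˡ (zeroˡ 0#)) (zeroʳ x)))
                       (trans (+-identityʳ _) (+-identityˡ 0#))) }
          ; 1#-homo = K².refl }
        ; -‿homo = λ a → refl , sym -0#≈0# }
      ; injective = proj₁ }
    ; α = 0# , 1#
    -- The second root is x - α.
    ; β = x , - 1#
    ; roots = record
      { sum-≈ = +-identityˡ x , -‿inverseʳ 1#
      ; product-≈ = A.trans (Algebra.Properties.Ring.-1*x≈-x A.ring _)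
          (A.trans (A.-‿cong αβ≈-y) (-‿involutive y , -0#≈0#)) }
    }
    where
    module A = CommutativeRing K[α]
    αβ≈-y : (0# , 1#) ⊛ (x , - 1#) K².≈ (- y , 0#)
    αβ≈-y =
      trans (+-cong (zeroˡ x) (trans (*-congˡ (*-identityˡ _)) (trans (*-comm _ _) (-1*x≈-x y))))
        (+-identityˡ _) ,
      trans (+-cong (trans (+-cong (zeroˡ _) (*-identityˡ x)) (+-identityˡ x))
                    (trans (*-congˡ (*-identityˡ _)) (trans (*-comm _ _) (-1*x≈-x x))))
        (-‿inverseʳ x)

-- The exponents of -1 and y

-- The value j(j-1)/2 expressed without subtraction or division, so that the exponents can be
-- compared by semiring identities.
triangle-double : ∀ j → triangle j * 2 + j ≡ j * j
triangle-double zero    = ≡.refl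
triangle-double (suc j) = begin
  (j + triangle j) * 2 + suc j
    ≡⟨ solve 2 (λ j t → (j :+ t) :* con 2 :+ (con 1 :+ j) := con 1 :+ j :* con 2 :+ (t :* con 2 :+ j))
         ≡.refl j (triangle j) ⟩
  1 + j * 2 + (triangle j * 2 + j)
    ≡⟨ ≡.cong (_+_ (1 + j * 2)) (triangle-double j) ⟩
  1 + j * 2 + j * j
    ≡⟨ solve 1 (λ j → con 1 :+ j :* con 2 :+ j :* j := (con 1 :+ j) :* (con 1 :+ j)) ≡.refl j ⟩
  suc j * suc j ∎
  where
  open Data.Nat.Solver.+-*-Solver
  open ≡.≡-Reasoning

y-exponent : ∀ s j → s * j * (j ∸ 1) / 2 ≡ s * triangle j
y-exponent s j = ≡.trans (≡.cong (_/ 2) (doubled j)) (m*n/n≡m (s * triangle j) 2)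
  where
  open Data.Nat.Solver.+-*-Solver
  doubled : ∀ j → s * j * (j ∸ 1) ≡ s * triangle j * 2
  doubled zero    = solve 1 (λ s → s :* con 0 :* con 0 := s :* con 0 :* con 2) ≡.refl s
  doubled (suc i) = ≡.trans
    (solve 2 (λ s i → s :* (con 1 :+ i) :* i := s :* (i :+ i :* i)) ≡.refl s i)
    (≡.trans (≡.cong (λ r → s * (i + r)) (≡.sym (triangle-double i)))
      (solve 3 (λ s i t → s :* (i :+ (t :* con 2 :+ i)) := s :* (i :+ t) :* con 2)
        ≡.refl s i (triangle i)))

-- The summands are sorted by their effect on the sign: s + 1 is the overall sign, j alternates, s ·
-- `triangle j` turns the power of y into one of -y, and the last summand is even.
sign-exponent : ∀ s j → (s * j + 2 * (s + 1)) * (j + 1) / 2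
                        ≡ suc s + (j + (s * triangle j + 2 * (s * j)))
sign-exponent s j = ≡.trans (≡.cong (_/ 2) doubled) (m*n/n≡m e 2)
  where
  open Data.Nat.Solver.+-*-Solver
  e = suc s + (j + (s * triangle j + 2 * (s * j)))
  doubled : (s * j + 2 * (s + 1)) * (j + 1) ≡ e * 2
  doubled = ≡.trans
    (solve 2 (λ s j → (s :* j :+ con 2 :* (s :+ con 1)) :* (j :+ con 1) :=
       s :* (j :* j) :+ con 3 :* (s :* j) :+ con 2 :* s :+ con 2 :* j :+ con 2) ≡.refl s j)
    (≡.trans (≡.cong (λ r → s * r + 3 * (s * j) + 2 * s + 2 * j + 2) (≡.sym (triangle-double j)))
      (solve 3 (λ s j t →
         s :* (t :* con 2 :+ j) :+ con 3 :* (s :* j) :+ con 2 :* s :+ con 2 :* j :+ con 2 :=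
         (con 1 :+ s :+ (j :+ (s :* t :+ con 2 :* (s :* j)))) :* con 2) ≡.refl s j (triangle j)))

-- Fibonacci polynomials at integer indices

module FibonacciProperties {c ℓ₁ ℓ₂ c′ ℓ₁′ ℓ₂′} {k : HeytingField c ℓ₁ ℓ₂} {K : HeytingField c′ ℓ₁′ ℓ₂′}
                           (k⟨x,y⟩ : RationalFunctionField k K) where
  open Fibonacci k⟨x,y⟩ hiding (Carrier; _≈_; _#_; 0#; 1#; -_; _⊹_; _·_; _^_)
  open HeytingField K using (_#_; heytingCommutativeRing)

  commutativeRing : CommutativeRing c′ ℓ₁′
  commutativeRing = HeytingCommutativeRing.commutativeRing heytingCommutativeRing

  open CommutativeRing commutativeRing renaming (_+_ to _⊹_; _*_ to _·_)
  open Algebra.Apartness.Properties.HeytingCommutativeRing heytingCommutativeRing using (#-congʳ)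
  open Algebra.Properties.Ring ring using (-1*x≈-x)
  open Algebra.Properties.CommutativeSemiring.Exp commutativeSemiring
  open Algebra.Solver.Ring.NaturalCoefficients.Default commutativeSemiring
    using (solve; _:+_; _:*_; _:=_)
  open MinusOne commutativeRing
  open SecondOrderRecurrence commutativeRing using (Solves)
  open Relation.Binary.Reasoning.Setoid setoid
  open IsRingHomomorphism ι-isHomomorphism using (+-homo; 0#-homo; 1#-homo)
  private
    module k where
      open HeytingField k public
      open Algebra.Apartness.Properties.HeytingCommutativeRing
        (HeytingField.heytingCommutativeRing k) public

  #0-cancelʳ : ∀ {a b d} → d # 0# → a · d ≈ b · d → a ≈ b
  #0-cancelʳ {a} {b} {d} d#0 ad≈bd = begin
    a                    ≈⟨ cancel a ⟨
    a · d · inv d d#0    ≈⟨ *-congʳ ad≈bd ⟩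
    b · d · inv d d#0    ≈⟨ cancel b ⟩
    b                    ∎
    where
    cancel : ∀ e → e · d · inv d d#0 ≈ e
    cancel e = trans (*-assoc _ _ _) (trans (*-congˡ (inv-inverseʳ d d#0)) (*-identityʳ e))

  x²+4y : Carrier
  x²+4y = x · x ⊹ (y ⊹ y ⊹ (y ⊹ y))

  -- The rows of the polynomial are 4y, 0 and 1, for x⁰, x¹ and x². Its witness of being nonzero is
  -- the coefficient 1 of x², which works in every characteristic, also where 4 = 0.
  x²+4y#0 : x²+4y # 0#
  x²+4y#0 = #-congʳ ⟦x²+4y⟧
    (algebraicallyIndependent ((k.0# ∷ four ∷ []) ∷ [] ∷ (k.1# ∷ []) ∷ []) (there (there (here (here k.1#0)))))
    where
    four = (k.1# k.+ k.1#) k.+ (k.1# k.+ k.1#)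

    ι-four : ι four ≈ (1# ⊹ 1#) ⊹ (1# ⊹ 1#)
    ι-four = trans (+-homo _ _) (+-cong ι-two ι-two)
      where
      ι-two = trans (+-homo _ _) (+-cong 1#-homo 1#-homo)

    a+r0≈a : ∀ {a} r → a ⊹ r · 0# ≈ a
    a+r0≈a r = trans (+-congˡ (zeroʳ r)) (+-identityʳ _)

    two : y · (1# ⊹ 1#) ≈ y ⊹ y
    two = trans (distribˡ y 1# 1#) (+-cong (*-identityʳ y) (*-identityʳ y))

    ⟦x²+4y⟧ : ⟦ (k.0# ∷ four ∷ []) ∷ [] ∷ (k.1# ∷ []) ∷ [] ⟧ ≈ x²+4y
    ⟦x²+4y⟧ = begin
      (ι k.0# ⊹ y · (ι four ⊹ y · 0#)) ⊹ x · (0# ⊹ x · (ι k.1# ⊹ y · 0# ⊹ x · 0#))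
        ≈⟨ +-cong
             (trans (+-congʳ 0#-homo) (trans (+-identityˡ _) (*-congˡ (trans (a+r0≈a y) ι-four))))
             (*-congˡ (trans (+-identityˡ _) (trans
               (*-congˡ (trans (a+r0≈a x) (trans (a+r0≈a y) 1#-homo))) (*-identityʳ x)))) ⟩
      y · ((1# ⊹ 1#) ⊹ (1# ⊹ 1#)) ⊹ x · x
        ≈⟨ +-congʳ (trans (distribˡ y _ _) (+-cong two two)) ⟩
      (y ⊹ y) ⊹ (y ⊹ y) ⊹ x · x
        ≈⟨ +-comm _ _ ⟩
      x²+4y ∎

  u : Carrier
  u = inv (- y) -y#0

  -y·u≈1 : ν · y · u ≈ 1#
  -y·u≈1 = trans (*-congʳ (-1*x≈-x y)) (inv-inverseʳ (- y) -y#0)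

  -- The inverse of the power is replaced by a power of the single inverse `u`, so that values at
  -- neighbouring negative indices become comparable.
  F-negative : ∀ n → F -[1+ n ] ≈ ν · (u ^ suc n · fib (suc n))
  F-negative n = trans (sym (-1*x≈-x _)) (*-congˡ (*-congʳ (#0-cancelʳ (^#0 -y#0 (suc n)) (begin
    inv ((- y) ^ suc n) (^#0 -y#0 (suc n)) · (- y) ^ suc n
      ≈⟨ trans (*-comm _ _) (inv-inverseʳ _ (^#0 -y#0 (suc n))) ⟩
    1#
      ≈⟨ 1^n≈1 (suc n) ⟨
    1# ^ suc n
      ≈⟨ ^-congˡ (suc n) (trans (*-comm _ _) (inv-inverseʳ (- y) -y#0)) ⟨
    (u · - y) ^ suc n
      ≈⟨ ^-distrib-* u (- y) (suc n) ⟩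
    u ^ suc n · (- y) ^ suc n ∎))))

  -- Expand fib(n+2) in the last term and use -y u = 1: the part with x cancels the first term, and
  -- the part with y leaves yu · uⁿ fib(n) = -uⁿ fib(n).
  negative-recurrence : ∀ n → ν · (u ^ n · fib n) ≈
    x · (ν · (u ^ suc n · fib (suc n))) ⊹ y · (ν · (u ^ suc (suc n) · fib (suc (suc n))))
  negative-recurrence n = sym (begin
    x · (ν · (u · U · f₁)) ⊹ y · (ν · (u · (u · U) · (x · f₁ ⊹ y · f₀)))
      ≈⟨ solve 7 (λ x y n u U f₀ f₁ →
           x :* (n :* (u :* U :* f₁)) :+ y :* (n :* (u :* (u :* U) :* (x :* f₁ :+ y :* f₀))) :=
           (n :* y :* u) :* (x :* (u :* U) :* f₁ :+ y :* u :* (U :* f₀)) :+ n :* (x :* (u :* U) :* f₁))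
           refl x y ν u U f₀ f₁ ⟩
    ν · y · u · (t ⊹ y · u · (U · f₀)) ⊹ ν · t
      ≈⟨ +-congʳ (trans (*-congʳ -y·u≈1) (*-identityˡ _)) ⟩
    t ⊹ y · u · (U · f₀) ⊹ ν · t
      ≈⟨ solve 3 (λ a b c → a :+ b :+ c := b :+ (a :+ c)) refl _ _ _ ⟩
    y · u · (U · f₀) ⊹ (t ⊹ ν · t)
      ≈⟨ x+y+νy≈x _ t ⟩
    y · u · (U · f₀)
      ≈⟨ trans (*-congʳ ν·ν≈1) (*-identityˡ _) ⟨
    ν · ν · (y · u · (U · f₀))
      ≈⟨ solve 4 (λ n y u b → n :* n :* (y :* u :* b) := n :* ((n :* y :* u) :* b)) refl ν y u _ ⟩
    ν · (ν · y · u · (U · f₀))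
      ≈⟨ *-congˡ (trans (*-congʳ -y·u≈1) (*-identityˡ _)) ⟩
    ν · (U · f₀) ∎)
    where
    U  = u ^ n
    f₀ = fib n
    f₁ = fib (suc n)
    t  = x · (u · U) · f₁

  F-recurrence : ∀ i → F (+ 1 +ℤ (+ 1 +ℤ i)) ≈ x · F (+ 1 +ℤ i) ⊹ y · F i
  F-recurrence (+ n) = refl
  F-recurrence -[1+ 0 ] = sym (begin
    x · 0# ⊹ y · F -[1+ 0 ]          ≈⟨ +-cong (zeroʳ x) (*-congˡ (F-negative 0)) ⟩
    0# ⊹ y · (ν · (u · 1# · 1#))     ≈⟨ +-identityˡ _ ⟩
    y · (ν · (u · 1# · 1#))          ≈⟨ *-congˡ (*-congˡ (trans (*-identityʳ _) (*-identityʳ u))) ⟩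
    y · (ν · u)                      ≈⟨ solve 3 (λ y n u → y :* (n :* u) := n :* y :* u) refl y ν u ⟩
    ν · y · u                        ≈⟨ -y·u≈1 ⟩
    1#                               ∎)
  F-recurrence -[1+ 1 ] = begin
    0#                                       ≈⟨ trans (*-congˡ (zeroʳ 1#)) (zeroʳ ν) ⟨
    ν · (1# · 0#)                            ≈⟨ negative-recurrence 0 ⟩
    x · (ν · (u ^ 1 · fib 1)) ⊹ y · (ν · (u ^ 2 · fib 2))
      ≈⟨ +-cong (*-congˡ (F-negative 0)) (*-congˡ (F-negative 1)) ⟨
    x · F -[1+ 0 ] ⊹ y · F -[1+ 1 ] ∎
  F-recurrence -[1+ suc (suc n) ] = begin
    F -[1+ n ]                               ≈⟨ F-negative n ⟩
    ν · (u ^ suc n · fib (suc n))            ≈⟨ negative-recurrence (suc n) ⟩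
    x · (ν · (u ^ suc (suc n) · fib (suc (suc n)))) ⊹
      y · (ν · (u ^ suc (suc (suc n)) · fib (suc (suc (suc n)))))
      ≈⟨ +-cong (*-congˡ (F-negative (suc n))) (*-congˡ (F-negative (suc (suc n)))) ⟨
    x · F -[1+ suc n ] ⊹ y · F -[1+ suc (suc n) ] ∎

  -- This reduces an integer offset m, possibly negative, to a choice of initial values, for which
  -- Binet's formula holds in general.
  F-shift-solves : ∀ m → Solves x y (λ n → F (+ n +ℤ m))
  F-shift-solves m n = begin
    F (+ suc (suc n) +ℤ m)
      ≡⟨ ≡.cong F (≡.trans (ℤ.+-assoc (+ 1) (+ suc n) m) (≡.cong (+ 1 +ℤ_) suc-shift)) ⟩
    F (+ 1 +ℤ (+ 1 +ℤ (+ n +ℤ m)))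
      ≈⟨ F-recurrence (+ n +ℤ m) ⟩
    x · F (+ 1 +ℤ (+ n +ℤ m)) ⊹ y · F (+ n +ℤ m)
      ≡⟨ ≡.cong (λ i → x · F i ⊹ y · F (+ n +ℤ m)) suc-shift ⟨
    x · F (+ suc n +ℤ m) ⊹ y · F (+ n +ℤ m) ∎
    where
    suc-shift : + suc n +ℤ m ≡ + 1 +ℤ (+ n +ℤ m)
    suc-shift = ℤ.+-assoc (+ 1) (+ n) m

  product-last : ∀ j (h : ℕ → Carrier) →
                 product {suc j} (h ∘ toℕ) ≈ product {j} (h ∘ toℕ) · h j
  product-last zero    h = *-comm _ _
  product-last (suc j) h = trans (*-congˡ (product-last j (h ∘ suc))) (sym (*-assoc _ _ _))

  -- s-Fibopolynomials and the coefficients of the denominator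

  module Fibonomial (s : ℕ) .{{_ : NonZero s}} where
    numerator : ℕ → ℕ → Carrier
    numerator n j = product {j} (λ i → fib (s * (n ∸ toℕ i)))

    denominator : ℕ → Carrier
    denominator j = product {j} (λ i → fib (suc (toℕ i) * s))

    denominator#0 : ∀ j → denominator j # 0#
    denominator#0 j = product#0 {j} _ (λ i → fib#0 (suc (toℕ i) * s) {{ℕ.m*n≢0 (suc (toℕ i)) s}})

    fibonom-denominator : ∀ n j → fibonom s n j · denominator j ≈ numerator n j
    fibonom-denominator n j = begin
      numerator n j · inv (denominator j) (denominator#0 j) · denominator j
        ≈⟨ *-assoc _ _ _ ⟩
      numerator n j · (inv (denominator j) (denominator#0 j) · denominator j)
        ≈⟨ *-congˡ (trans (*-comm _ _) (inv-inverseʳ _ (denominator#0 j))) ⟩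
      numerator n j · 1#
        ≈⟨ *-identityʳ _ ⟩
      numerator n j ∎

    numerator-last : ∀ n j → numerator n (suc j) ≈ numerator n j · fib (s * (n ∸ j))
    numerator-last n j = product-last j (λ i → fib (s * (n ∸ i)))

    denominator-last : ∀ j → denominator (suc j) ≈ denominator j · fib (suc j * s)
    denominator-last j = product-last j (λ i → fib (suc i * s))

    fibonom-0 : ∀ n → fibonom s n 0 ≈ 1#
    fibonom-0 n = trans (sym (*-identityʳ _)) (fibonom-denominator n 0)

    fibonom-beyond : ∀ n → fibonom s n (suc n) ≈ 0#
    fibonom-beyond n = trans (*-congʳ numerator≈0) (zeroˡ _)
      where
      numerator≈0 : numerator n (suc n) ≈ 0#
      numerator≈0 = begin
        numerator n (suc n)              ≈⟨ numerator-last n n ⟩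
        numerator n n · fib (s * (n ∸ n)) ≡⟨ ≡.cong (λ r → numerator n n · fib r)
                                               (≡.trans (≡.cong (s *_) (ℕ.n∸n≡0 n)) (ℕ.*-zeroʳ s)) ⟩
        numerator n n · 0#               ≈⟨ zeroʳ _ ⟩
        0#                               ∎

    coefficient : ℕ → ℕ → Carrier
    coefficient N j = ν ^ ((s * j + 2 * (s + 1)) * (j + 1) / 2) · fibonom s N j
                        · y ^ (s * j * (j ∸ 1) / 2)

    -- The sign (-1)^(s · `triangle j`) joins the power of y to give a power of (-y)^s. As -y = αβ,
    -- this is `characteristic` for αˢ and βˢ, up to the constant sign.
    coefficient≈ : ∀ N j → coefficient N j ≈
                           ν ^ suc s · (ν ^ j · (((ν · y) ^ s) ^ triangle j · fibonom s N j))
    coefficient≈ N j = begin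
      ν ^ ((s * j + 2 * (s + 1)) * (j + 1) / 2) · B · y ^ (s * j * (j ∸ 1) / 2)
        ≈⟨ *-cong (*-congʳ (^-congʳ ν (sign-exponent s j))) (^-congʳ y (y-exponent s j)) ⟩
      ν ^ (suc s + (j + (sT + 2 * (s * j)))) · B · y ^ sT
        ≈⟨ *-congʳ (*-congʳ (begin
             ν ^ (suc s + (j + (sT + 2 * (s * j))))
               ≈⟨ ^-homo-* ν (suc s) _ ⟩
             ν ^ suc s · ν ^ (j + (sT + 2 * (s * j)))
               ≈⟨ *-congˡ (^-homo-* ν j _) ⟩
             ν ^ suc s · (ν ^ j · ν ^ (sT + 2 * (s * j)))
               ≈⟨ *-congˡ (*-congˡ (trans (^-homo-* ν sT _)
                    (trans (*-congˡ (ν^2n≈1 (s * j))) (*-identityʳ _)))) ⟩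
             ν ^ suc s · (ν ^ j · ν ^ sT) ∎)) ⟩
      ν ^ suc s · (ν ^ j · ν ^ sT) · B · y ^ sT
        ≈⟨ solve 5 (λ S J N B Y → S :* (J :* N) :* B :* Y := S :* (J :* (N :* Y :* B))) refl _ _ _ _ _ ⟩
      ν ^ suc s · (ν ^ j · (ν ^ sT · y ^ sT · B))
        ≈⟨ *-congˡ (*-congˡ (*-congʳ (trans (^-assocʳ (ν · y) s (triangle j)) (^-distrib-* ν y sT)))) ⟨
      ν ^ suc s · (ν ^ j · (((ν · y) ^ s) ^ triangle j · B)) ∎
      where
      sT = s * triangle j
      B = fibonom s N j

    -- The leading coefficient is (-1)^(s+1), which is its own inverse.
    leading-unit : ∀ N → ν ^ suc s · coefficient N 0 ≈ 1#
    leading-unit N = begin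
      ν ^ suc s · coefficient N 0
        ≈⟨ *-congˡ (coefficient≈ N 0) ⟩
      ν ^ suc s · (ν ^ suc s · (1# · (1# · fibonom s N 0)))
        ≈⟨ *-congˡ (trans (*-congˡ (trans (*-identityˡ _) (trans (*-identityˡ _) (fibonom-0 N))))
             (*-identityʳ _)) ⟩
      ν ^ suc s · ν ^ suc s
        ≈⟨ ^-homo-* ν (suc s) (suc s) ⟨
      ν ^ (suc s + suc s)
        ≈⟨ ^-congʳ ν (≡.cong (λ r → suc s + r) (≡.sym (ℕ.+-identityʳ (suc s)))) ⟩
      ν ^ (2 * suc s)
        ≈⟨ ν^2n≈1 (suc s) ⟩
      1# ∎

-- The recurrence, proved in the extension and brought back to K

module SplitFibonacci {c ℓ₁ ℓ₂ c′ ℓ₁′ ℓ₂′} {k : HeytingField c ℓ₁ ℓ₂} {K : HeytingField c′ ℓ₁′ ℓ₂′}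
  (k⟨x,y⟩ : RationalFunctionField k K)
  (extension : SplitExtension (FibonacciProperties.commutativeRing k⟨x,y⟩)
                              (RationalFunctionField.x k⟨x,y⟩) (RationalFunctionField.y k⟨x,y⟩))
  (s : ℕ) .{{_ : NonZero s}} where
  private
    module K = CommutativeRing (FibonacciProperties.commutativeRing k⟨x,y⟩)
  open Fibonacci k⟨x,y⟩ using (x; y; fib; F; fibonom; inv; inv-inverseʳ)
  open FibonacciProperties k⟨x,y⟩
    using (commutativeRing; x²+4y; x²+4y#0; #0-cancelʳ; F-shift-solves; module Fibonomial)
  open Fibonomial s
  open SplitExtension extension using (ε; isMonomorphism; α; β; roots) renaming (ring to A)
  open IsRingMonomorphism isMonomorphism
    using (injective; +-homo; *-homo; 0#-homo; 1#-homo; -‿homo) renaming (⟦⟧-cong to ε-cong)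
  open CommutativeRing A renaming (_+_ to _⊹_; _*_ to _·_)
  open Algebra.Properties.CommutativeSemiring.Exp commutativeSemiring
  open Algebra.Solver.Ring.NaturalCoefficients.Default commutativeSemiring
    using (solve; _:+_; _:*_; _:=_)
  open MinusOne A
  private
    module νᴷ = MinusOne commutativeRing
    module ^ᴷ = Algebra.Properties.CommutativeSemiring.Exp K.commutativeSemiring
  open FiniteSums A
  open Annihilation A
  open SecondOrderRecurrence A
  open Relation.Binary.Reasoning.Setoid setoid

  p q : Carrier
  p = α ^ s
  q = β ^ s

  ε-solves : ∀ {g} → SecondOrderRecurrence.Solves commutativeRing x y g →
             Solves (ε x) (ε y) (ε ∘ g)
  ε-solves {g} g-solves n = begin
    ε (g (suc (suc n)))
      ≈⟨ ε-cong (g-solves n) ⟩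
    ε (x K.* g (suc n) K.+ y K.* g n)
      ≈⟨ trans (+-homo _ _) (+-cong (*-homo _ _) (*-homo _ _)) ⟩
    ε x · ε (g (suc n)) ⊹ ε y · ε (g n) ∎

  ε-^ : ∀ a n → ε (a ^ᴷ.^ n) ≈ ε a ^ n
  ε-^ a zero    = 1#-homo
  ε-^ a (suc n) = trans (*-homo _ _) (*-congˡ (ε-^ a n))

  ε-ν : ε νᴷ.ν ≈ ν
  ε-ν = trans (-‿homo _) (-‿cong 1#-homo)

  ε-∑ : ∀ n f → ε (FiniteSums.∑≤ commutativeRing n f) ≈ ∑≤ n (ε ∘ f)
  ε-∑ zero    f = trans (+-homo _ _) (+-congˡ 0#-homo)
  ε-∑ (suc n) f = trans (+-homo _ _) (+-congˡ (ε-∑ n (f ∘ suc)))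

  f : ℕ → Carrier
  f = ε ∘ fib

  f-addition : ∀ m n → f (m + n) ≈ α ^ m · f n ⊹ β ^ n · f m
  f-addition = f-+ roots {f} (ε-solves {fib} (λ _ → K.refl)) 0#-homo 1#-homo

  B : ℕ → ℕ → Carrier
  B n j = ε (fibonom s n j)

  -- The extension has no inverses of its own, but `ε` maps the inverse taken in K to an inverse.
  cancel-denominator : ∀ j {a b} → a · ε (denominator j) ≈ b · ε (denominator j) → a ≈ b
  cancel-denominator j {a} {b} ad≈bd = begin
    a                ≈⟨ cancel a ⟨
    a · ε d · ε d⁻¹  ≈⟨ *-congʳ ad≈bd ⟩
    b · ε d · ε d⁻¹  ≈⟨ cancel b ⟩
    b                ∎
    where
    d   = denominator j
    d⁻¹ = inv d (denominator#0 j)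
    cancel : ∀ e → e · ε d · ε d⁻¹ ≈ e
    cancel e = begin
      e · ε d · ε d⁻¹    ≈⟨ *-assoc _ _ _ ⟩
      e · (ε d · ε d⁻¹)  ≈⟨ *-congˡ (*-homo d d⁻¹) ⟨
      e · ε (d K.* d⁻¹)  ≈⟨ *-congˡ (trans (ε-cong (inv-inverseʳ d (denominator#0 j))) 1#-homo) ⟩
      e · 1#             ≈⟨ *-identityʳ e ⟩
      e                  ∎

  B-denominator : ∀ n j → B n j · ε (denominator j) ≈ ε (numerator n j)
  B-denominator n j = trans (sym (*-homo _ _)) (ε-cong (fibonom-denominator n j))

  B-0 : ∀ n → B (suc n) 0 ≈ B n 0
  B-0 n = ε-cong (K.trans (fibonom-0 (suc n)) (K.sym (fibonom-0 n)))

  B-beyond : ∀ n → B n (suc n) ≈ 0#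
  B-beyond n = trans (ε-cong (fibonom-beyond n)) 0#-homo

  -- Cleared of denominators, this is the addition formula at s(n+1) = (j+1)s + s(n-j), multiplied
  -- by `numerator n j`.
  B-pascal : ∀ n j → j ≤ n → B (suc n) (suc j) ≈ p ^ suc j · B n (suc j) ⊹ q ^ (n ∸ j) · B n j
  B-pascal n j j≤n = cancel-denominator (suc j) (begin
    B (suc n) (suc j) · ε (denominator (suc j))
      ≈⟨ B-denominator (suc n) (suc j) ⟩
    -- The first factor splits off by definition, since s((n+1) - (i+1)) reduces to s(n-i): the
    -- others form `numerator n j`.
    ε (fib (s * suc n) K.* numerator n j)
      ≈⟨ *-homo _ _ ⟩
    f (s * suc n) · M
      ≈⟨ *-congʳ (begin
           f (s * suc n)
             ≡⟨ ≡.cong f index ⟩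
           f (suc j * s + s * (n ∸ j))
             ≈⟨ f-addition (suc j * s) (s * (n ∸ j)) ⟩
           α ^ (suc j * s) · f₁ ⊹ β ^ (s * (n ∸ j)) · f₂
             ≈⟨ +-cong (*-congʳ (trans (^-congʳ α (ℕ.*-comm (suc j) s)) (sym (^-assocʳ α s (suc j)))))
                       (*-congʳ (sym (^-assocʳ β s (n ∸ j)))) ⟩
           p ^ suc j · f₁ ⊹ q ^ (n ∸ j) · f₂ ∎) ⟩
    (p ^ suc j · f₁ ⊹ q ^ (n ∸ j) · f₂) · M
      ≈⟨ solve 5 (λ P f₁ Q f₂ M → (P :* f₁ :+ Q :* f₂) :* M := P :* (M :* f₁) :+ Q :* (M :* f₂))
           refl _ _ _ _ _ ⟩
    p ^ suc j · (M · f₁) ⊹ q ^ (n ∸ j) · (M · f₂)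
      -- The index s(n-j) is the next factor of the numerator, and (j+1)s the next factor of the
      -- denominator.
      ≈⟨ +-cong (*-congˡ (begin
           M · f₁
             ≈⟨ *-homo _ _ ⟨
           ε (numerator n j K.* fib (s * (n ∸ j)))
             ≈⟨ ε-cong (numerator-last n j) ⟨
           ε (numerator n (suc j))
             ≈⟨ B-denominator n (suc j) ⟨
           B n (suc j) · ε (denominator (suc j)) ∎))
         (*-congˡ (begin
           M · f₂
             ≈⟨ *-congʳ (B-denominator n j) ⟨
           B n j · ε (denominator j) · f₂
             ≈⟨ *-assoc _ _ _ ⟩
           B n j · (ε (denominator j) · f₂)
             ≈⟨ *-congˡ (trans (ε-cong (denominator-last j)) (*-homo _ _)) ⟨
           B n j · ε (denominator (suc j)) ∎)) ⟩
    p ^ suc j · (B n (suc j) · D) ⊹ q ^ (n ∸ j) · (B n j · D)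
      ≈⟨ solve 5 (λ P B₁ Q B₀ D → P :* (B₁ :* D) :+ Q :* (B₀ :* D) := (P :* B₁ :+ Q :* B₀) :* D)
           refl _ _ _ _ _ ⟩
    (p ^ suc j · B n (suc j) ⊹ q ^ (n ∸ j) · B n j) · D ∎)
    where
    M  = ε (numerator n j)
    D  = ε (denominator (suc j))
    f₁ = f (s * (n ∸ j))
    f₂ = f (suc j * s)
    index : s * suc n ≡ suc j * s + s * (n ∸ j)
    index = ≡.trans (≡.cong (λ r → s * suc r) (≡.sym (ℕ.m+[n∸m]≡n j≤n)))
      (≡.trans (ℕ.*-distribˡ-+ s (suc j) (n ∸ j)) (≡.cong (λ r → r + s * (n ∸ j)) (ℕ.*-comm s (suc j))))

  pascalRule : PascalRule A p q B
  pascalRule = record { B-0 = B-0 ; B-pascal = B-pascal ; B-beyond = B-beyond }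

  open GaussianBinomials A p q B pascalRule

  ε-coefficient : ∀ N j → ε (coefficient N j) ≈ ν ^ suc s · characteristic N j
  ε-coefficient N j = begin
    ε (coefficient N j)
      ≈⟨ ε-cong (coefficient≈ N j) ⟩
    ε (νᴷ.ν ^ᴷ.^ suc s K.* (νᴷ.ν ^ᴷ.^ j K.* (((νᴷ.ν K.* y) ^ᴷ.^ s) ^ᴷ.^ triangle j K.* fibonom s N j)))
      ≈⟨ trans (*-homo _ _) (*-cong (ε-ν^ (suc s)) (trans (*-homo _ _) (*-cong (ε-ν^ j) (*-homo _ _)))) ⟩
    ν ^ suc s · (ν ^ j · (ε (((νᴷ.ν K.* y) ^ᴷ.^ s) ^ᴷ.^ triangle j) · B N j))
      ≈⟨ *-congˡ (*-congˡ (*-congʳ (trans (ε-^ _ (triangle j)) (^-congˡ (triangle j) ε[-y]^s≈pq)))) ⟩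
    ν ^ suc s · characteristic N j ∎
    where
    ε-ν^ : ∀ n → ε (νᴷ.ν ^ᴷ.^ n) ≈ ν ^ n
    ε-ν^ n = trans (ε-^ νᴷ.ν n) (^-congˡ n ε-ν)

    ε[-y]^s≈pq : ε ((νᴷ.ν K.* y) ^ᴷ.^ s) ≈ p · q
    ε[-y]^s≈pq = begin
      ε ((νᴷ.ν K.* y) ^ᴷ.^ s)   ≈⟨ ε-^ _ s ⟩
      ε (νᴷ.ν K.* y) ^ s        ≈⟨ ^-congˡ s (trans (*-homo _ _) (*-cong ε-ν (sym (Roots.product-≈ roots)))) ⟩
      (ν · (ν · (α · β))) ^ s   ≈⟨ ^-congˡ s (trans (sym (*-assoc _ _ _))
                                     (trans (*-congʳ ν·ν≈1) (*-identityˡ _))) ⟩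
      (α · β) ^ s               ≈⟨ ^-distrib-* α β s ⟩
      p · q                     ∎

  ^-regroup : ∀ a t n → a ^ (t * s * n) ≈ ((a ^ s) ^ t) ^ n
  ^-regroup a t n = begin
    a ^ (t * s * n)      ≈⟨ ^-congʳ a (≡.cong (_* n) (ℕ.*-comm t s)) ⟩
    a ^ (s * t * n)      ≈⟨ ^-assocʳ a (s * t) n ⟨
    (a ^ (s * t)) ^ n    ≈⟨ ^-congˡ n (^-assocʳ a s t) ⟨
    ((a ^ s) ^ t) ^ n    ∎

  G : ℕ → ℤ → ℕ → K.Carrier
  G t m n = F (+ (t * s * n) +ℤ m)

  Δ : Carrier
  Δ = δ roots

  binet-F : ∀ t m → ∃₂ λ c d → ∀ n → Δ · ε (G t m n) ≈ c · (p ^ t) ^ n ⊹ d · (q ^ t) ^ n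
  binet-F t m = _ , _ , λ n → trans
    (binet roots {λ i → ε (F (+ i +ℤ m))} (ε-solves {λ i → F (+ i +ℤ m)} (F-shift-solves m)) (t * s * n))
    (+-cong (*-congˡ (^-regroup α t n)) (*-congˡ (^-regroup β t n)))

  -- Multiplying by x² + 4y = (α - β)² supplies each of the two Fibonacci factors with the α - β
  -- that Binet's formula asks for. Since x² + 4y comes from K, it is cancelled there once `ε` has
  -- been removed.
  recurrence : ∀ N t₁ t₂ → N ≡ suc (t₁ + t₂) → ∀ m₁ m₂ →
    Annihilation.Annihilates commutativeRing N (coefficient N) (λ n → G t₁ m₁ n K.* G t₂ m₂ n)
  recurrence .(suc (t₁ + t₂)) t₁ t₂ ≡.refl m₁ m₂ k = #0-cancelʳ x²+4y#0 (injective (begin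
    ε (S K.* x²+4y)                      ≈⟨ *-homo S x²+4y ⟩
    ε S · ε x²+4y                        ≈⟨ *-cong (ε-∑ N d·a) (trans ε[x²+4y] (sym (δ·δ≈x²+4y roots))) ⟩
    ∑≤ N (ε ∘ d·a) · (Δ · Δ)             ≈⟨ *-comm _ _ ⟩
    Δ · Δ · ∑≤ N (ε ∘ d·a)               ≈⟨ *-∑ N (Δ · Δ) (ε ∘ d·a) ⟩
    ∑≤ N (λ j → Δ · Δ · ε (d·a j))       ≈⟨ ∑-cong N (λ j _ → step j (N + k ∸ j)) ⟩
    ∑≤ N (λ j → ν ^ suc s · e·b j)       ≈⟨ *-∑ N (ν ^ suc s) e·b ⟨
    ν ^ suc s · ∑≤ N e·b                 ≈⟨ *-congˡ (annihilated k) ⟩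
    ν ^ suc s · 0#                       ≈⟨ zeroʳ _ ⟩
    0#                                   ≈⟨ 0#-homo ⟨
    ε K.0#                               ≈⟨ ε-cong (K.zeroˡ x²+4y) ⟨
    ε (K.0# K.* x²+4y)                   ∎))
    where
    N = suc (t₁ + t₂)

    b : ℕ → Carrier
    b n = Δ · ε (G t₁ m₁ n) · (Δ · ε (G t₂ m₂ n))

    d·a : ℕ → K.Carrier
    d·a j = coefficient N j K.* (G t₁ m₁ (N + k ∸ j) K.* G t₂ m₂ (N + k ∸ j))

    e·b : ℕ → Carrier
    e·b j = characteristic N j · b (N + k ∸ j)

    S = FiniteSums.∑≤ commutativeRing N d·a

    annihilated : Annihilates N (characteristic N) b
    annihilated = product-annihilated t₁ t₂ {λ n → Δ · ε (G t₁ m₁ n)} {λ n → Δ · ε (G t₂ m₂ n)}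
      (proj₂ (proj₂ (binet-F t₁ m₁))) (proj₂ (proj₂ (binet-F t₂ m₂)))

    ε[x²+4y] : ε x²+4y ≈ ε x · ε x ⊹ (ε y ⊹ ε y ⊹ (ε y ⊹ ε y))
    ε[x²+4y] = trans (+-homo _ _) (+-cong (*-homo _ _)
      (trans (+-homo _ _) (+-cong (+-homo _ _) (+-homo _ _))))

    step : ∀ j n → Δ · Δ · ε (coefficient N j K.* (G t₁ m₁ n K.* G t₂ m₂ n)) ≈ ν ^ suc s · (characteristic N j · b n)
    step j n = begin
      Δ · Δ · ε (coefficient N j K.* (G t₁ m₁ n K.* G t₂ m₂ n))
        ≈⟨ *-congˡ (trans (*-homo _ _) (*-cong (ε-coefficient N j) (*-homo _ _))) ⟩
      Δ · Δ · (ν ^ suc s · characteristic N j · (ε (G t₁ m₁ n) · ε (G t₂ m₂ n)))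
        ≈⟨ solve 5 (λ D S C a b → D :* D :* (S :* C :* (a :* b)) := S :* (C :* (D :* a :* (D :* b))))
             refl _ _ _ _ _ ⟩
      ν ^ suc s · (characteristic N j · b n) ∎

-- The Z transform of the product

theorem7 : ∀ {c ℓ₁ ℓ₂ c′ ℓ₁′ ℓ₂′}
  (k : HeytingField c ℓ₁ ℓ₂) (K : HeytingField c′ ℓ₁′ ℓ₂′)
  (k⟨x,y⟩ : RationalFunctionField k K) →
  let open Fibonacci k⟨x,y⟩ in
  (s : ℕ) .{{_ : NonZero s}} (m₁ m₂ : ℤ) (t₁ t₂ : ℕ) →
  𝒵 (λ n → F (+ (t₁ * s * n) +ℤ m₁) · F (+ (t₂ * s * n) +ℤ m₂))
  ≐
    z *ᴸ (∑[ i ≤ t₁ + t₂ ] ∑[ j ≤ i ]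
      ((- 1#) ^ ((s * j + 2 * (s + 1)) * (j + 1) / 2)
        · fibonom s (t₁ + t₂ + 1) j
        · F (m₁ +ℤ + (t₁ * s * (i ∸ j))) · F (m₂ +ℤ + (t₂ * s * (i ∸ j)))
        · y ^ (s * j * (j ∸ 1) / 2)) z^ (t₁ + t₂ ∸ i))
  ÷
    (∑[ i ≤ t₁ + t₂ + 1 ]
      ((- 1#) ^ ((s * i + 2 * (s + 1)) * (i + 1) / 2)
        · fibonom s (t₁ + t₂ + 1) i
        · y ^ (s * i * (i ∸ 1) / 2)) z^ (t₁ + t₂ + 1 ∸ i))
theorem7 k K k⟨x,y⟩ s m₁ m₂ t₁ t₂ =
  𝒵-recurrence (t₁ + t₂ + 1) (t₁ + t₂) (λ n → G t₁ m₁ n K.* G t₂ m₂ n) (coefficient (t₁ + t₂ + 1)) _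
    N≡1+T (leading-unit (t₁ + t₂ + 1)) (recurrence (t₁ + t₂ + 1) t₁ t₂ N≡1+T m₁ m₂) entry
  where
  open Fibonacci k⟨x,y⟩ using (F; fibonom; y)
  open FibonacciProperties k⟨x,y⟩ using (commutativeRing; module Fibonomial)
  open Fibonomial s using (coefficient; leading-unit)
  module K = CommutativeRing commutativeRing
  open LaurentQuotients commutativeRing using (𝒵-recurrence)
  open SplitFibonacci k⟨x,y⟩ (QuadraticExtension.splitExtension commutativeRing _ _) s
    using (G; recurrence)
  open MinusOne commutativeRing using (ν)
  open Algebra.Properties.CommutativeSemiring.Exp K.commutativeSemiring using (_^_)
  open Algebra.Solver.Ring.NaturalCoefficients.Default K.commutativeSemiring
    using (solve; _:*_; _:=_)

  N≡1+T : t₁ + t₂ + 1 ≡ suc (t₁ + t₂)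
  N≡1+T = ℕ.+-comm (t₁ + t₂) 1

  entry : ∀ i j → coefficient (t₁ + t₂ + 1) j K.* (G t₁ m₁ (i ∸ j) K.* G t₂ m₂ (i ∸ j)) K.≈
    ν ^ ((s * j + 2 * (s + 1)) * (j + 1) / 2) K.* fibonom s (t₁ + t₂ + 1) j
      K.* F (m₁ +ℤ + (t₁ * s * (i ∸ j))) K.* F (m₂ +ℤ + (t₂ * s * (i ∸ j)))
      K.* y ^ (s * j * (j ∸ 1) / 2)
  entry i j
    rewrite ℤ.+-comm m₁ (+ (t₁ * s * (i ∸ j))) | ℤ.+-comm m₂ (+ (t₂ * s * (i ∸ j))) =
    solve 5 (λ S B Y F₁ F₂ → S :* B :* Y :* (F₁ :* F₂) := S :* B :* F₁ :* F₂ :* Y)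
      K.refl _ _ _ _ _
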